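{- For every simple graph with $n$ vertices (i.e. when the adjacency variables satisfy $a_{ij}\in\{0,1\}$), the parameters $\sigma_e^v$ and $h_e^v$ ($e\ge1$) are in the linear correspondence $$\sigma_e^v=\sum_{w=\omega(e)}^{v}\sum_{f=1}^{e}(-1)^{e-f+v-w}\,\frac{\sigma_{e-f}([e-1])\ \prod_{j=1}^{v-w}(n-v+j)}{e!\,(v-w)!}\,h_f^w,$$ where $\omega(x)=\left\lceil\tfrac12+\tfrac{\sqrt{1+8x}}{2}\right\rceil$ and $\sigma_a([b])=\sigma_a(1,2,\ldots,b)$ with $\sigma_a$ the classical elementary symmetric polynomial of degree $a$.
   Context: Graphs are finite and simple. For a graph $\mathcal{G}$ with $n$ vertices, $$\sigma_e^v(\mathcal{G})=\sum_{A\subseteq\mathcal{G},\,cv(A)=v,\,|A|=e}I(A)(\mathcal{G}),$$ where the sum is over unlabeled subgraphs $A$ (without isolated vertices), $I(A)(\mathcal{G})$ is the number of (not necessarily induced) subgraphs of $\mathcal{G}$ isomorphic to $A$, $cv(A)$ is the number of vertices connected to edges of $A$ and $|A|$ is the number of edges of $A$. Further $$h_e^v(\mathcal{G})=\sum_{A\subseteq\mathcal{G},\,v(A)=v}|A|^e,$$ where the sum is over all $v$-vertex subsets of $\mathcal{G}$ and $A$ is the subgraph of $\mathcal{G}$ induced on the subset. $\sigma_0([b])=1$ and $\sigma_a([b])=0$ for $a>b$. -}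

module Defs where

open import Data.Bool.Base using (Bool; true; false)
import Data.Bool.Properties as Bool
open import Data.Fin.Base using (Fin; toℕ)
import Data.Fin.Properties as Fin
open import Data.Integer.Base as ℤ using (ℤ; +_; -[1+_]; 0ℤ; 1ℤ)
import Data.Integer.Properties as ℤ
open import Data.List.Base
  using (List; []; _∷_; _++_; map; filter; length; sum; product; applyUpTo;
         allFin; cartesianProduct; deduplicate)
import Data.List.Membership.DecPropositional as DecMembership
open import Data.List.Membership.Propositional using (_∈_)
open import Data.Nat.Base using (ℕ; zero; suc; _+_; _*_; _∸_; _^_; _≤_; z≤n; s≤s)
import Data.Nat.Properties as ℕ
open import Data.Nat.Solver using (module +-*-Solver)
open import Data.Product.Base using (∃; ∃₂; _×_; _,_; proj₁; proj₂)
open import Data.Product.Properties using (≡-dec)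
open import Data.Rational.Base using (ℚ)
import Data.Rational.Properties as ℚ
open import Data.Sum.Base using (_⊎_)
open import Data.Vec.Base using (Vec; []; _∷_; lookup)
open import Relation.Binary.Definitions using (DecidableEquality) renaming (Decidable to Decidable₂)
open import Relation.Binary.PropositionalEquality using (_≡_; refl; sym; cong; subst; module ≡-Reasoning)
open import Relation.Nullary using (Dec; yes; no; contradiction)
open import Relation.Nullary.Decidable using (_×-dec_; _⊎-dec_; _→-dec_; map′)
open import Relation.Unary using (Decidable)

import Algebra.Properties.CommutativeMonoid.Sum as BigOp
private
  module Σℚ = BigOp ℚ.+-0-commutativeMonoid
  module Πℤ = BigOp ℤ.*-1-commutativeMonoid

-- Over a, a + 1, …, b; empty if b < a.
sumFromTo : ℕ → ℕ → (ℕ → ℚ) → ℚ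
sumFromTo a b f = Σℚ.sum {suc b ∸ a} (λ i → f (a + toℕ i))

productFromTo : ℕ → ℕ → (ℕ → ℤ) → ℤ
productFromTo a b f = Πℤ.sum {suc b ∸ a} (λ i → f (a + toℕ i))

infixr 5 sumFromTo productFromTo
syntax sumFromTo a b (λ i → x) = ∑[ i from a to b ] x
syntax productFromTo a b (λ i → x) = ∏[ i from a to b ] x

-- If xs is duplicate-free, these are the subsets of its set of elements,
-- each listed once.
sublists : {A : Set} → List A → List (List A)
sublists []       = [] ∷ []
sublists (x ∷ xs) = sublists xs ++ map (x ∷_) (sublists xs)

sublistsOfSize : {A : Set} → ℕ → List A → List (List A)
sublistsOfSize k xs = filter (λ ys → length ys ℕ.≟ k) (sublists xs)

-- Repeated entries of the argument count as distinct variables.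
elementarySymmetric : ℕ → List ℕ → ℕ
elementarySymmetric a xs = sum (map product (sublistsOfSize a xs))

[1⋯_] : ℕ → List ℕ
[1⋯ b ] = applyUpTo suc b

record Graph (n : ℕ) : Set where
  field
    adj    : Fin n → Fin n → Bool
    symm   : ∀ i j → adj i j ≡ adj j i
    irrefl : ∀ i → adj i i ≡ false

-- The edge between i and j is represented by the ordered pair with i < j.
Edge : ℕ → Set
Edge n = Fin n × Fin n

edges : ∀ {n} → Graph n → List (Edge n)
edges {n} G =
  filter (λ (i , j) → (i Fin.<? j) ×-dec (Graph.adj G i j Bool.≟ true))
         (cartesianProduct (allFin n) (allFin n))

-- A subgraph without isolated vertices is determined by its edges; its
-- vertices are the endpoints of those edges.
Subgraph : ℕ → Set
Subgraph n = List (Edge n)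

subgraphs : ∀ {n} → Graph n → List (Subgraph n)
subgraphs G = sublists (edges G)

module _ {n : ℕ} where

  private
    _≟ᵉ_ : DecidableEquality (Edge n)
    _≟ᵉ_ = ≡-dec Fin._≟_ Fin._≟_

  open DecMembership _≟ᵉ_ using () renaming (_∈?_ to _∈ᵉ?_)
  open DecMembership (Fin._≟_ {n}) using () renaming (_∈?_ to _∈ᵛ?_)

  Adjacent : Subgraph n → Fin n → Fin n → Set
  Adjacent A i j = (i , j) ∈ A ⊎ (j , i) ∈ A

  Adjacent? : ∀ A → Decidable₂ (Adjacent A)
  Adjacent? A i j = ((i , j) ∈ᵉ? A) ⊎-dec ((j , i) ∈ᵉ? A)

  Vertex : Subgraph n → Fin n → Set
  Vertex A i = ∃ λ j → Adjacent A i j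

  Vertex? : ∀ A → Decidable (Vertex A)
  Vertex? A i = Fin.any? (Adjacent? A i)

  cv : Subgraph n → ℕ
  cv A = length (filter (Vertex? A) (allFin n))

  -- φ restricts to a bijection from the vertices of A to those of B, with
  -- inverse the restriction of ψ, which preserves and reflects adjacency.
  -- The values of φ and ψ elsewhere are irrelevant.
  IsIsomorphism : (A B : Subgraph n) (φ ψ : Fin n → Fin n) → Set
  IsIsomorphism A B φ ψ =
      (∀ i → Vertex A i → Vertex B (φ i) × ψ (φ i) ≡ i)
    × (∀ i → Vertex B i → Vertex A (ψ i) × φ (ψ i) ≡ i)
    × (∀ i j → Vertex A i → Vertex A j →
         (Adjacent A i j → Adjacent B (φ i) (φ j))
       × (Adjacent B (φ i) (φ j) → Adjacent A i j))

  isIsomorphism? : ∀ A B φ ψ → Dec (IsIsomorphism A B φ ψ)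
  isIsomorphism? A B φ ψ =
    Fin.all? (λ i → Vertex? A i →-dec (Vertex? B (φ i) ×-dec (ψ (φ i) Fin.≟ i)))
    ×-dec
    Fin.all? (λ i → Vertex? B i →-dec (Vertex? A (ψ i) ×-dec (φ (ψ i) Fin.≟ i)))
    ×-dec
    Fin.all? (λ i → Fin.all? λ j → Vertex? A i →-dec (Vertex? A j →-dec
      ((Adjacent? A i j →-dec Adjacent? B (φ i) (φ j))
       ×-dec
       (Adjacent? B (φ i) (φ j) →-dec Adjacent? A i j))))

  -- Maps Fin n → Fin n are given by their tables of values, so that the
  -- existence of an isomorphism is decidable by exhaustive search.
  infix 4 _≅_
  _≅_ : Subgraph n → Subgraph n → Set
  A ≅ B = ∃₂ λ (φ ψ : Vec (Fin n) n) → IsIsomorphism A B (lookup φ) (lookup ψ)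

  private
    anyVec? : ∀ {k} {P : Vec (Fin n) k → Set} → Decidable P → Dec (∃ P)
    anyVec? {zero}  P? = map′ ([] ,_) (λ { ([] , p) → p }) (P? [])
    anyVec? {suc k} P? =
      map′ (λ (x , xs , p) → x ∷ xs , p) (λ { (x ∷ xs , p) → x , xs , p })
           (Fin.any? λ x → anyVec? λ xs → P? (x ∷ xs))

  infix 4 _≅?_
  _≅?_ : Decidable₂ _≅_
  A ≅? B = anyVec? λ φ → anyVec? λ ψ → isIsomorphism? A B (lookup φ) (lookup ψ)

  I : Subgraph n → Graph n → ℕ
  I A G = length (filter (A ≅?_) (subgraphs G))

  -- One representative of each isomorphism class.
  unlabeledSubgraphs : Graph n → (e v : ℕ) → List (Subgraph n)
  unlabeledSubgraphs G e v =
    deduplicate _≅?_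
      (filter (λ A → (cv A ℕ.≟ v) ×-dec (length A ℕ.≟ e)) (subgraphs G))

  σ : Graph n → (e v : ℕ) → ℕ
  σ G e v = sum (map (λ A → I A G) (unlabeledSubgraphs G e v))

  inducedEdges : Graph n → List (Fin n) → List (Edge n)
  inducedEdges G S = filter (λ (i , j) → (i ∈ᵛ? S) ×-dec (j ∈ᵛ? S)) (edges G)

  h : Graph n → (e v : ℕ) → ℕ
  h G e v =
    sum (map (λ S → length (inducedEdges G S) ^ e) (sublistsOfSize v (allFin n)))

-- Inequalities between real square roots and integers, stated without reals:
-- √y ≤ z iff z ≥ 0 and y ≤ z², and 1/2 + √y/2 ≤ k iff √y ≤ 2k − 1.
√_≤_ : ℕ → ℤ → Set
√ y ≤ z = 0ℤ ℤ.≤ z × + y ℤ.≤ z ℤ.* z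

½+½√[1+8_]≤_ : ℕ → ℤ → Set
½+½√[1+8 x ]≤ k = √ (1 + 8 * x) ≤ (+ 2 ℤ.* k ℤ.- 1ℤ)

IsCeiling : ℕ → ℕ → Set
IsCeiling x m = ½+½√[1+8 x ]≤ (+ m) × (∀ k → ½+½√[1+8 x ]≤ k → + m ℤ.≤ k)

private
  bound? : ∀ x k → Dec (½+½√[1+8 x ]≤ k)
  bound? x k = (0ℤ ℤ.≤? _) ×-dec (_ ℤ.≤? _)

  least : {P : ℕ → Set} → Decidable P → ∀ b → P b →
          ∃ λ m → P m × (∀ k → P k → m ≤ k)
  least P? zero p = zero , p , λ _ _ → z≤n
  least P? (suc b) p with P? zero
  ... | yes p₀ = zero , p₀ , λ _ _ → z≤n
  ... | no ¬p₀ with least (λ k → P? (suc k)) b p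
  ...   | m , pₘ , min = suc m , pₘ ,
          λ { zero p₀ → contradiction p₀ ¬p₀ ; (suc k) pₖ → s≤s (min k pₖ) }

  2[1+x]-1≡1+2x : ∀ x → + 2 ℤ.* + suc x ℤ.- 1ℤ ≡ + suc (2 * x)
  2[1+x]-1≡1+2x x = begin
    + 2 ℤ.* + suc x ℤ.- 1ℤ   ≡⟨ cong (ℤ._- 1ℤ) (ℤ.pos-* 2 (suc x)) ⟨
    + (2 * suc x) ℤ.- 1ℤ     ≡⟨ cong (λ y → + y ℤ.- 1ℤ) (ℕ.*-suc 2 x) ⟩
    + (2 + 2 * x) ℤ.- 1ℤ     ≡⟨⟩
    + suc (2 * x)            ∎
    where open ≡-Reasoning

  x≤x*x : ∀ x → x ≤ x * x
  x≤x*x zero      = z≤n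
  x≤x*x x@(suc _) = ℕ.m≤m*n x x

  1+8x≤[1+2x]² : ∀ x → 1 + 8 * x ≤ suc (2 * x) * suc (2 * x)
  1+8x≤[1+2x]² x = begin
    1 + 8 * x                     ≡⟨ solve 1 (λ y → con 1 :+ con 8 :* y := con 1 :+ con 4 :* y :+ con 4 :* y) refl x ⟩
    1 + 4 * x + 4 * x             ≤⟨ ℕ.+-monoʳ-≤ (1 + 4 * x) (ℕ.*-monoʳ-≤ 4 (x≤x*x x)) ⟩
    1 + 4 * x + 4 * (x * x)       ≡⟨ solve 1 (λ y → con 1 :+ con 4 :* y :+ con 4 :* (y :* y) := (con 1 :+ con 2 :* y) :* (con 1 :+ con 2 :* y)) refl x ⟩
    suc (2 * x) * suc (2 * x)     ∎
    where open ℕ.≤-Reasoning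
          open +-*-Solver

  bound-1+x : ∀ x → ½+½√[1+8 x ]≤ (+ suc x)
  bound-1+x x = subst (√ (1 + 8 * x) ≤_) (sym (2[1+x]-1≡1+2x x))
    ( ℤ.+≤+ z≤n
    , subst (+ (1 + 8 * x) ℤ.≤_) (ℤ.pos-* (suc (2 * x)) (suc (2 * x)))
            (ℤ.+≤+ (1+8x≤[1+2x]² x)))

  ceiling : ∀ x → ∃ (IsCeiling x)
  ceiling x with least (λ m → bound? x (+ m)) (suc x) (bound-1+x x)
  ... | m , pₘ , min = m , pₘ , λ where
          (+ k)    pₖ → ℤ.+≤+ (min k pₖ)
          -[1+ k ] (() , _)

-- ⌈1/2 + √(1 + 8x)/2⌉.
ω : ℕ → ℕ
ω x = proj₁ (ceiling x)

ω-isCeiling : ∀ x → IsCeiling x (ω x)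
ω-isCeiling x = proj₂ (ceiling x)

{-# OPTIONS --safe #-}
module Submission where

-- Grouping the e-edge subgraphs by isomorphism class only reorganises a count: σ_e^v is the
-- number of e-subsets of edges covering exactly v vertices. Those covering only vertices of
-- a given set S, whose induced subgraph has m edges, number C(m, e), and
-- e! C(m, e) = m (m − 1) ⋯ (m − e + 1) expands in powers of m with signed coefficients
-- σ_{e−f}([e−1]); summed over the w-subsets S this turns into a combination of the h_f^w.
-- Exactly v covered vertices is recovered by inversion: for every U ⊆ [n],
--   Σ_{S ⊇ U} (−1)^{v−|S|} C(n − |S|, v − |S|) = [ |U| = v ].
-- Sets S with fewer than ω(e) vertices span fewer than e edges and contribute nothing.

open import Defs
import Algebra.Properties.CommutativeMonoid.Sum as BigOp
open import Data.Bool.Base using (true; false; if_then_else_)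
import Data.Bool.Properties as Bool
open import Data.Fin.Base as Fin using (Fin; toℕ)
import Data.Fin.Properties as Fin
open import Data.Integer.Base as ℤ using (ℤ; +_; -1ℤ; 0ℤ; 1ℤ)
import Data.Integer.Properties as ℤ
open import Data.Integer.Tactic.RingSolver using (solve-∀)
open import Data.List.Base
  using (List; []; _∷_; _++_; _∷ʳ_; map; filter; length; applyUpTo; allFin; cartesianProduct; deduplicate)
import Data.List.Membership.DecPropositional as DecMembership
open import Data.List.Membership.Propositional using (_∈_; _∉_; find; lose)
open import Data.List.Membership.Propositional.Properties
  using (∈-++⁻; ∈-++⁺ˡ; ∈-++⁺ʳ; ∈-map⁺; ∈-map⁻; ∈-filter⁺; ∈-filter⁻; ∈-∃++; ∈-allFin; ∈-applyUpTo⁺; ∈-applyUpTo⁻)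
open import Data.List.Properties
  using (map-applyUpTo; applyUpTo-∷ʳ; length-applyUpTo; filter-accept; filter-reject; length-++; length-map;
         length-tabulate)
open import Data.List.Relation.Binary.Sublist.Propositional using (_⊆_; []; _∷_; lookup) renaming (_∷ʳ_ to _∷ˢ_)
open import Data.List.Relation.Binary.Sublist.Propositional.Properties using (length-mono-≤)
import Data.List.Relation.Binary.Subset.Propositional as Subset
open import Data.List.Relation.Unary.All as All using (All; []; _∷_; all?)
open import Data.List.Relation.Unary.All.Properties using (anti-mono)
open import Data.List.Relation.Unary.AllPairs using (AllPairs; []; _∷_)
import Data.List.Relation.Unary.AllPairs.Properties as AllPairs
open import Data.List.Relation.Unary.Any using (Any; here; there; any?)
open import Data.List.Relation.Unary.Unique.Propositional using (Unique)
import Data.List.Relation.Unary.Unique.Propositional.Properties as Unique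
open import Data.Nat.Base as ℕ using (ℕ; zero; suc; _+_; _*_; _∸_; _^_; _≤_; _<_; z≤n; s≤s; _!)
open import Data.Nat.Combinatorics using (_C_; k>n⇒nCk≡0; nCk+nC[k+1]≡[n+1]C[k+1])
open import Data.Nat.ListAction using (sum; product)
import Data.Nat.Properties as ℕ
open import Data.Nat.Properties using (_!*_!≢0)
open import Data.Nat.Solver using (module +-*-Solver)
open import Data.Product.Base using (_×_; _,_; proj₁; proj₂)
open import Data.Rational.Base as ℚ using (ℚ; _/_)
import Data.Rational.Properties as ℚ
open import Data.Rational.Unnormalised.Base using (mkℚᵘ; *≡*)
import Data.Rational.Unnormalised.Properties as ℚᵘ
open import Data.Sum.Base using (inj₁; inj₂)
open import Data.Vec.Base using (tabulate) renaming (lookup to lookupᵛ)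
open import Data.Vec.Properties using (lookup∘tabulate)
open import Function.Base using (_∘_; id)
open import Level using (0ℓ)
open import Relation.Binary.Core using (Rel)
open import Relation.Binary.Definitions
  using (DecidableEquality; Reflexive; Symmetric; Transitive) renaming (Decidable to Decidable₂)
open import Relation.Binary.PropositionalEquality
open import Relation.Nullary using (¬_; Dec; yes; no; contradiction; does)
open import Relation.Nullary.Decidable using (_×-dec_; _→-dec_; ¬?; dec-true; dec-false)
open import Relation.Unary using (Decidable)

open DecMembership ℕ._≟_ using () renaming (_∈?_ to _∈ℕ?_)
open ≡-Reasoning

-- The inversion identity is Möbius inversion on the lattice of subsets: C(n - |S|, v - |S|) counts
-- the v-sets T ⊇ S, so the left side is the sum, over the v-sets T ⊇ U, of Σ_{U ⊆ S ⊆ T}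
-- (-1)^{|T|-|S|}, and this inner sum is 0 unless T = U. The formal proof introduces no T; it is an
-- induction along the list of vertices, driven by Pascal's rule. The fraction ∏ (n - v + j) / (v -
-- w)! of the statement equals C(n - w, v - w) only while w ≤ n. Beyond that all its factors are
-- negative and it is nonzero, so those terms have to vanish through h_f^w = 0. The numbers
-- σ_{e-f}([e-1]) arise by Vieta from (m - 1) ⋯ (m - e + 1). The remaining root 0 supplies a
-- separate factor m, which is why the powers start at f = 1 and the variables stop at e - 1. All
-- counting takes place in ℤ; the denominators e! (v - w)! enter only at the end, where each inner
-- sum turns out to be an integer multiple of its denominator.

private
  module Σℚ = BigOp ℚ.+-0-commutativeMonoid
  module Πℤ = BigOp ℤ.*-1-commutativeMonoid

  variable
    A B : Set
    P Q : Set

-- Finite sums over lists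

∑ : List A → (A → ℤ) → ℤ
∑ []       f = 0ℤ
∑ (x ∷ xs) f = f x ℤ.+ ∑ xs f

infixr 5 ∑
syntax ∑ xs (λ x → t) = ∑[ x ∈ xs ] t

∑-cong : ∀ (xs : List A) {f g : A → ℤ} → (∀ {x} → x ∈ xs → f x ≡ g x) → ∑ xs f ≡ ∑ xs g
∑-cong []       f≡g = refl
∑-cong (x ∷ xs) f≡g = cong₂ ℤ._+_ (f≡g (here refl)) (∑-cong xs (f≡g ∘ there))

∑-zero : ∀ (xs : List A) {f : A → ℤ} → (∀ {x} → x ∈ xs → f x ≡ 0ℤ) → ∑ xs f ≡ 0ℤ
∑-zero []       f≡0 = refl
∑-zero (x ∷ xs) f≡0 = cong₂ ℤ._+_ (f≡0 (here refl)) (∑-zero xs (f≡0 ∘ there))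

∑-++ : ∀ (xs ys : List A) (f : A → ℤ) → ∑ (xs ++ ys) f ≡ ∑ xs f ℤ.+ ∑ ys f
∑-++ []       ys f = sym (ℤ.+-identityˡ _)
∑-++ (x ∷ xs) ys f = trans (cong (λ s → f x ℤ.+ s) (∑-++ xs ys f)) (sym (ℤ.+-assoc (f x) _ _))

∑-map : ∀ (g : A → B) (xs : List A) (f : B → ℤ) → ∑ (map g xs) f ≡ ∑ xs (f ∘ g)
∑-map g []       f = refl
∑-map g (x ∷ xs) f = cong (λ s → f (g x) ℤ.+ s) (∑-map g xs f)

∑-distrib-+ : ∀ (xs : List A) (f g : A → ℤ) → (∑[ x ∈ xs ] (f x ℤ.+ g x)) ≡ ∑ xs f ℤ.+ ∑ xs g
∑-distrib-+ []       f g = refl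
∑-distrib-+ (x ∷ xs) f g = begin
  f x ℤ.+ g x ℤ.+ ∑ xs (λ y → f y ℤ.+ g y)  ≡⟨ cong (λ s → f x ℤ.+ g x ℤ.+ s) (∑-distrib-+ xs f g) ⟩
  f x ℤ.+ g x ℤ.+ (∑ xs f ℤ.+ ∑ xs g)       ≡⟨ interchange (f x) (g x) (∑ xs f) (∑ xs g) ⟩
  f x ℤ.+ ∑ xs f ℤ.+ (g x ℤ.+ ∑ xs g)       ∎
  where
  interchange : ∀ a b c d → a ℤ.+ b ℤ.+ (c ℤ.+ d) ≡ a ℤ.+ c ℤ.+ (b ℤ.+ d)
  interchange = solve-∀

*-distribˡ-∑ : ∀ (c : ℤ) (xs : List A) (f : A → ℤ) → c ℤ.* ∑ xs f ≡ (∑[ x ∈ xs ] (c ℤ.* f x))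
*-distribˡ-∑ c []       f = ℤ.*-zeroʳ c
*-distribˡ-∑ c (x ∷ xs) f =
  trans (ℤ.*-distribˡ-+ c (f x) _) (cong (λ s → c ℤ.* f x ℤ.+ s) (*-distribˡ-∑ c xs f))

∑-comm : ∀ (xs : List A) (ys : List B) (f : A → B → ℤ) →
         (∑[ x ∈ xs ] ∑[ y ∈ ys ] f x y) ≡ (∑[ y ∈ ys ] ∑[ x ∈ xs ] f x y)
∑-comm []       ys f = sym (∑-zero ys λ _ → refl)
∑-comm (x ∷ xs) ys f = begin
  ∑ ys (f x) ℤ.+ (∑[ x ∈ xs ] ∑[ y ∈ ys ] f x y)  ≡⟨ cong (λ s → ∑ ys (f x) ℤ.+ s) (∑-comm xs ys f) ⟩
  ∑ ys (f x) ℤ.+ (∑[ y ∈ ys ] ∑[ x ∈ xs ] f x y)  ≡⟨ ∑-distrib-+ ys (f x) _ ⟨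
  (∑[ y ∈ ys ] (f x y ℤ.+ (∑[ x ∈ xs ] f x y)))   ∎

+-sum : ∀ (f : A → ℕ) (xs : List A) → + sum (map f xs) ≡ (∑[ x ∈ xs ] (+ f x))
+-sum f []       = refl
+-sum f (x ∷ xs) = trans (ℤ.pos-+ (f x) _) (cong (λ s → + f x ℤ.+ s) (+-sum f xs))

-- As integer factors, the conditions on a range of summation survive an exchange of sums and can be
-- pulled out of either one.
⟦_⟧ : Dec P → ℤ
⟦ P? ⟧ = if does P? then 1ℤ else 0ℤ

⟦⟧-true : (P? : Dec P) → P → ⟦ P? ⟧ ≡ 1ℤ
⟦⟧-true (yes _) p = refl
⟦⟧-true (no ¬p) p = contradiction p ¬p

⟦⟧-false : (P? : Dec P) → ¬ P → ⟦ P? ⟧ ≡ 0ℤ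
⟦⟧-false (yes p) ¬p = contradiction p ¬p
⟦⟧-false (no _)  ¬p = refl

⟦⟧-cong : (P? : Dec P) (Q? : Dec Q) → (P → Q) → (Q → P) → ⟦ P? ⟧ ≡ ⟦ Q? ⟧
⟦⟧-cong P? (yes q) f g = ⟦⟧-true P? (g q)
⟦⟧-cong P? (no ¬q) f g = ⟦⟧-false P? (¬q ∘ f)

⟦⟧-× : (P? : Dec P) (Q? : Dec Q) → ⟦ P? ×-dec Q? ⟧ ≡ ⟦ P? ⟧ ℤ.* ⟦ Q? ⟧
⟦⟧-× (yes _) Q? = sym (ℤ.*-identityˡ ⟦ Q? ⟧)
⟦⟧-× (no _)  Q? = refl

∑-filter : {R : A → Set} (R? : Decidable R) (xs : List A) (f : A → ℤ) →
           ∑ (filter R? xs) f ≡ (∑[ x ∈ xs ] (⟦ R? x ⟧ ℤ.* f x))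
∑-filter R? []       f = refl
∑-filter R? (x ∷ xs) f with does (R? x)
... | true  = cong₂ ℤ._+_ (sym (ℤ.*-identityˡ (f x))) (∑-filter R? xs f)
... | false = trans (∑-filter R? xs f) (sym (ℤ.+-identityˡ _))

+-length-filter : {R : A → Set} (R? : Decidable R) (xs : List A) →
                  + length (filter R? xs) ≡ (∑[ x ∈ xs ] ⟦ R? x ⟧)
+-length-filter R? []       = refl
+-length-filter R? (x ∷ xs) with does (R? x)
... | true  = cong (λ s → 1ℤ ℤ.+ s) (+-length-filter R? xs)
... | false = trans (+-length-filter R? xs) (sym (ℤ.+-identityˡ _))

module _ (_≟_ : DecidableEquality A) where

  ∑-miss : ∀ {a} (xs : List A) (f : A → ℤ) → a ∉ xs → (∑[ x ∈ xs ] (⟦ a ≟ x ⟧ ℤ.* f x)) ≡ 0ℤ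
  ∑-miss {a} xs f a∉xs = ∑-zero xs λ {x} x∈xs →
    cong (ℤ._* f x) (⟦⟧-false (a ≟ x) (λ { refl → a∉xs x∈xs }))

  ∑-hit : ∀ {a} {xs : List A} (f : A → ℤ) → Unique xs → a ∈ xs →
          (∑[ x ∈ xs ] (⟦ a ≟ x ⟧ ℤ.* f x)) ≡ f a
  ∑-hit {a} {_ ∷ xs} f (a≢ ∷ _) (here refl) = begin
    ⟦ a ≟ a ⟧ ℤ.* f a ℤ.+ ∑ xs (λ x → ⟦ a ≟ x ⟧ ℤ.* f x)
      ≡⟨ cong₂ ℤ._+_ (cong (ℤ._* f a) (⟦⟧-true (a ≟ a) refl))
                     (∑-miss xs f λ a∈xs → All.lookup a≢ a∈xs refl) ⟩
    1ℤ ℤ.* f a ℤ.+ 0ℤ  ≡⟨ trans (ℤ.+-identityʳ _) (ℤ.*-identityˡ (f a)) ⟩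
    f a                ∎
  ∑-hit {a} {x ∷ xs} f (x≢ ∷ uniq) (there a∈xs) = begin
    ⟦ a ≟ x ⟧ ℤ.* f x ℤ.+ ∑ xs (λ x → ⟦ a ≟ x ⟧ ℤ.* f x)
      ≡⟨ cong₂ ℤ._+_ (cong (ℤ._* f x) (⟦⟧-false (a ≟ x) (All.lookup x≢ a∈xs ∘ sym)))
                     (∑-hit f uniq a∈xs) ⟩
    0ℤ ℤ.+ f a  ≡⟨ ℤ.+-identityˡ (f a) ⟩
    f a         ∎

*-swap : ∀ a b c → a ℤ.* (b ℤ.* c) ≡ b ℤ.* (a ℤ.* c)
*-swap = solve-∀

-- Expanding the filter into indicators and exchanging the sums leaves, for each `x`, a sum over
-- `ws` with the single live index `κ x`. An `x` whose `κ x` is not listed is lost on the left, so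
-- its term on the right has to be 0.
∑-group : (κ : A → ℕ) (F : ℕ → ℤ) (c : A → ℤ) (ws : List ℕ) (xs : List A) → Unique ws →
          (∀ {x} → x ∈ xs → κ x ∉ ws → F (κ x) ℤ.* c x ≡ 0ℤ) →
          (∑[ w ∈ ws ] (F w ℤ.* ∑ (filter (λ x → κ x ℕ.≟ w) xs) c)) ≡
          (∑[ x ∈ xs ] (F (κ x) ℤ.* c x))
∑-group κ F c ws xs uniq outside = begin
  (∑[ w ∈ ws ] (F w ℤ.* ∑ (filter (λ x → κ x ℕ.≟ w) xs) c))
    ≡⟨ ∑-cong ws (λ {w} _ → trans (cong (F w ℤ.*_) (∑-filter (λ x → κ x ℕ.≟ w) xs c))
                                  (*-distribˡ-∑ (F w) xs _)) ⟩
  (∑[ w ∈ ws ] ∑[ x ∈ xs ] (F w ℤ.* (⟦ κ x ℕ.≟ w ⟧ ℤ.* c x)))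
    ≡⟨ ∑-comm ws xs _ ⟩
  (∑[ x ∈ xs ] ∑[ w ∈ ws ] (F w ℤ.* (⟦ κ x ℕ.≟ w ⟧ ℤ.* c x)))
    ≡⟨ ∑-cong xs (λ {x} x∈xs → trans (∑-cong ws (λ {w} _ → *-swap (F w) ⟦ κ x ℕ.≟ w ⟧ (c x)))
                                     (pick x∈xs)) ⟩
  (∑[ x ∈ xs ] (F (κ x) ℤ.* c x))  ∎
  where
  pick : ∀ {x} → x ∈ xs →
         (∑[ w ∈ ws ] (⟦ κ x ℕ.≟ w ⟧ ℤ.* (F w ℤ.* c x))) ≡ F (κ x) ℤ.* c x
  pick {x} x∈xs with κ x ∈ℕ? ws
  ... | yes κx∈ws = ∑-hit ℕ._≟_ (λ w → F w ℤ.* c x) uniq κx∈ws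
  ... | no  κx∉ws = trans (∑-miss ℕ._≟_ ws (λ w → F w ℤ.* c x) κx∉ws) (sym (outside x∈xs κx∉ws))

-- Sublists

∑-sublists-∷ : ∀ (x : A) xs (f : List A → ℤ) →
               ∑ (sublists (x ∷ xs)) f ≡ ∑ (sublists xs) f ℤ.+ (∑[ S ∈ sublists xs ] f (x ∷ S))
∑-sublists-∷ x xs f = trans (∑-++ (sublists xs) _ f)
  (cong (λ s → ∑ (sublists xs) f ℤ.+ s) (∑-map (x ∷_) (sublists xs) f))

∈-sublists⁻ : ∀ {S} (xs : List A) → S ∈ sublists xs → S ⊆ xs
∈-sublists⁻ []       (here refl) = []
∈-sublists⁻ (x ∷ xs) S∈ with ∈-++⁻ (sublists xs) S∈
... | inj₁ S∈xs = x ∷ˢ ∈-sublists⁻ xs S∈xs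
... | inj₂ S∈map with ∈-map⁻ (x ∷_) S∈map
...   | _ , T∈xs , refl = refl ∷ ∈-sublists⁻ xs T∈xs

length-∈-sublists : ∀ {S} (xs : List A) → S ∈ sublists xs → length S ≤ length xs
length-∈-sublists xs = length-mono-≤ ∘ ∈-sublists⁻ xs

∑-sublists-size : ∀ k (xs : List A) →
                  (∑[ S ∈ sublists xs ] ⟦ length S ℕ.≟ k ⟧) ≡ + (length xs C k)
∑-sublists-size zero    []       = refl
∑-sublists-size (suc k) []       = refl
∑-sublists-size zero    (x ∷ xs) = begin
  (∑[ S ∈ sublists (x ∷ xs) ] ⟦ length S ℕ.≟ 0 ⟧)  ≡⟨ ∑-sublists-∷ x xs _ ⟩
  (∑[ S ∈ sublists xs ] ⟦ length S ℕ.≟ 0 ⟧) ℤ.+ (∑[ S ∈ sublists xs ] 0ℤ)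
    ≡⟨ cong₂ ℤ._+_ (∑-sublists-size zero xs) (∑-zero (sublists xs) λ _ → refl) ⟩
  1ℤ ℤ.+ 0ℤ  ∎
∑-sublists-size (suc k) (x ∷ xs) = begin
  (∑[ S ∈ sublists (x ∷ xs) ] ⟦ length S ℕ.≟ suc k ⟧)  ≡⟨ ∑-sublists-∷ x xs _ ⟩
  (∑[ S ∈ sublists xs ] ⟦ length S ℕ.≟ suc k ⟧) ℤ.+ (∑[ S ∈ sublists xs ] ⟦ length S ℕ.≟ k ⟧)
    ≡⟨ cong₂ ℤ._+_ (∑-sublists-size (suc k) xs) (∑-sublists-size k xs) ⟩
  + (length xs C suc k) ℤ.+ + (length xs C k)  ≡⟨ ℤ.+-comm (+ (length xs C suc k)) (+ (length xs C k)) ⟩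
  + (length xs C k + length xs C suc k)        ≡⟨ cong +_ (nCk+nC[k+1]≡[n+1]C[k+1] (length xs) k) ⟩
  + (suc (length xs) C suc k)                  ∎

-- With `R?` saying that an edge lies inside a vertex set, this turns the subgraphs of the graph
-- that lie inside the set into the subgraphs of the induced graph.
∑-sublists-filter : {R : A → Set} (R? : Decidable R) (xs : List A) (f : List A → ℤ) →
                    (∑[ S ∈ sublists xs ] (⟦ all? R? S ⟧ ℤ.* f S)) ≡ ∑ (sublists (filter R? xs)) f
∑-sublists-filter R? []       f = cong (ℤ._+ 0ℤ) (ℤ.*-identityˡ (f []))
∑-sublists-filter R? (x ∷ xs) f
  rewrite ∑-sublists-∷ x xs (λ S → ⟦ all? R? S ⟧ ℤ.* f S) with does (R? x)
... | true  = trans (cong₂ ℤ._+_ (∑-sublists-filter R? xs f) (∑-sublists-filter R? xs (f ∘ (x ∷_))))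
                    (sym (∑-sublists-∷ x (filter R? xs) f))
... | false = trans (cong₂ ℤ._+_ (∑-sublists-filter R? xs f) (∑-zero (sublists xs) λ _ → refl))
                    (ℤ.+-identityʳ _)

*-pull : ∀ s m p q → s ℤ.* (m ℤ.* p) ℤ.* q ≡ m ℤ.* (s ℤ.* p ℤ.* q)
*-pull = solve-∀

-- Falling factorials

fallingFactorial : ℤ → ℕ → ℤ
fallingFactorial x zero    = 1ℤ
fallingFactorial x (suc k) = fallingFactorial x k ℤ.* (x ℤ.- + k)


-- The definition splits off the last factor; Pascal's rule raises the top argument and needs the
-- first factor split off instead.
fallingFactorial-1+ : ∀ x k → fallingFactorial (1ℤ ℤ.+ x) (suc k) ≡ (1ℤ ℤ.+ x) ℤ.* fallingFactorial x k
fallingFactorial-1+ x zero    = base x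
  where
  base : ∀ x → 1ℤ ℤ.* (1ℤ ℤ.+ x ℤ.- 0ℤ) ≡ (1ℤ ℤ.+ x) ℤ.* 1ℤ
  base = solve-∀
fallingFactorial-1+ x (suc k) = begin
  fallingFactorial (1ℤ ℤ.+ x) (suc k) ℤ.* (1ℤ ℤ.+ x ℤ.- (1ℤ ℤ.+ + k))
    ≡⟨ cong (ℤ._* (1ℤ ℤ.+ x ℤ.- (1ℤ ℤ.+ + k))) (fallingFactorial-1+ x k) ⟩
  (1ℤ ℤ.+ x) ℤ.* fallingFactorial x k ℤ.* (1ℤ ℤ.+ x ℤ.- (1ℤ ℤ.+ + k))
    ≡⟨ step x (fallingFactorial x k) (+ k) ⟩
  (1ℤ ℤ.+ x) ℤ.* (fallingFactorial x k ℤ.* (x ℤ.- + k))  ∎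
  where
  step : ∀ x y k → (1ℤ ℤ.+ x) ℤ.* y ℤ.* (1ℤ ℤ.+ x ℤ.- (1ℤ ℤ.+ k)) ≡ (1ℤ ℤ.+ x) ℤ.* (y ℤ.* (x ℤ.- k))
  step = solve-∀

k!*nCk≡fallingFactorial : ∀ n k → + (k !) ℤ.* + (n C k) ≡ fallingFactorial (+ n) k
k!*nCk≡fallingFactorial zero    zero          = refl
k!*nCk≡fallingFactorial (suc n) zero          = refl
k!*nCk≡fallingFactorial zero    (suc k)       = trans (ℤ.*-zeroʳ (+ (suc k !))) (sym (vanishes k))
  where
  vanishes : ∀ k → fallingFactorial 0ℤ (suc k) ≡ 0ℤ
  vanishes zero    = refl
  vanishes (suc k) = cong (ℤ._* (0ℤ ℤ.- + suc k)) (vanishes k)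
k!*nCk≡fallingFactorial (suc n) (suc k) = begin
  + (suc k !) ℤ.* + (suc n C suc k)
    ≡⟨ cong (λ c → + (suc k !) ℤ.* + c) (nCk+nC[k+1]≡[n+1]C[k+1] n k) ⟨
  + (suc k !) ℤ.* (+ (n C k) ℤ.+ + (n C suc k))
    ≡⟨ ℤ.*-distribˡ-+ (+ (suc k !)) (+ (n C k)) _ ⟩
  + (suc k !) ℤ.* + (n C k) ℤ.+ + (suc k !) ℤ.* + (n C suc k)
    ≡⟨ cong₂ (λ a b → a ℤ.* + (n C k) ℤ.+ b) (ℤ.pos-* (suc k) (k !)) (k!*nCk≡fallingFactorial n (suc k)) ⟩
  + suc k ℤ.* + (k !) ℤ.* + (n C k) ℤ.+ fallingFactorial (+ n) (suc k)
    ≡⟨ cong (ℤ._+ fallingFactorial (+ n) (suc k))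
            (trans (ℤ.*-assoc (+ suc k) (+ (k !)) _) (cong (+ suc k ℤ.*_) (k!*nCk≡fallingFactorial n k))) ⟩
  (1ℤ ℤ.+ + k) ℤ.* fallingFactorial (+ n) k ℤ.+ fallingFactorial (+ n) k ℤ.* (+ n ℤ.- + k)
    ≡⟨ step (+ n) (fallingFactorial (+ n) k) (+ k) ⟩
  (1ℤ ℤ.+ + n) ℤ.* fallingFactorial (+ n) k
    ≡⟨ fallingFactorial-1+ (+ n) k ⟨
  fallingFactorial (+ suc n) (suc k)  ∎
  where
  step : ∀ x y k → (1ℤ ℤ.+ k) ℤ.* y ℤ.+ y ℤ.* (x ℤ.- k) ≡ (1ℤ ℤ.+ x) ℤ.* y
  step = solve-∀

-- The product ascends from x - k + 1 to x, while the falling factorial descends from x: the factor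
-- at `j = 1` is the last one of the latter.
∏-fallingFactorial : ∀ x k → (∏[ j from 1 to k ] (x ℤ.- + k ℤ.+ + j)) ≡ fallingFactorial x k
∏-fallingFactorial x zero    = refl
∏-fallingFactorial x (suc k) = begin
  (x ℤ.- + suc k ℤ.+ 1ℤ) ℤ.* Πℤ.sum {k} (λ i → x ℤ.- + suc k ℤ.+ + suc (suc (toℕ i)))
    ≡⟨ cong₂ ℤ._*_ (first x (+ k)) (Πℤ.sum-cong-≗ {k} λ i → shift x (+ k) (+ suc (toℕ i))) ⟩
  (x ℤ.- + k) ℤ.* (∏[ j from 1 to k ] (x ℤ.- + k ℤ.+ + j))
    ≡⟨ cong ((x ℤ.- + k) ℤ.*_) (∏-fallingFactorial x k) ⟩
  (x ℤ.- + k) ℤ.* fallingFactorial x k  ≡⟨ ℤ.*-comm (x ℤ.- + k) _ ⟩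
  fallingFactorial x k ℤ.* (x ℤ.- + k)  ∎
  where
  first : ∀ x k → x ℤ.- (1ℤ ℤ.+ k) ℤ.+ 1ℤ ≡ x ℤ.- k
  first = solve-∀
  shift : ∀ x k j → x ℤ.- (1ℤ ℤ.+ k) ℤ.+ (1ℤ ℤ.+ j) ≡ x ℤ.- k ℤ.+ j
  shift = solve-∀


-- Expansion of the falling factorial in powers

∏-roots : ℤ → List ℕ → ℤ
∏-roots m []       = 1ℤ
∏-roots m (x ∷ xs) = (m ℤ.- + x) ℤ.* ∏-roots m xs

∏-roots-∷ʳ : ∀ m xs x → ∏-roots m (xs ∷ʳ x) ≡ ∏-roots m xs ℤ.* (m ℤ.- + x)
∏-roots-∷ʳ m []       x = ℤ.*-comm (m ℤ.- + x) 1ℤ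
∏-roots-∷ʳ m (y ∷ xs) x =
  trans (cong ((m ℤ.- + y) ℤ.*_) (∏-roots-∷ʳ m xs x)) (sym (ℤ.*-assoc (m ℤ.- + y) _ _))

-- The leading `m` stands for the root 0, which is missing from `[1⋯ b ]`.
m*∏-roots≡fallingFactorial : ∀ m b → m ℤ.* ∏-roots m [1⋯ b ] ≡ fallingFactorial m (suc b)
m*∏-roots≡fallingFactorial m zero    = base m
  where
  base : ∀ m → m ℤ.* 1ℤ ≡ 1ℤ ℤ.* (m ℤ.- 0ℤ)
  base = solve-∀
m*∏-roots≡fallingFactorial m (suc b) = begin
  m ℤ.* ∏-roots m [1⋯ suc b ]                      ≡⟨ cong (λ xs → m ℤ.* ∏-roots m xs) (applyUpTo-∷ʳ suc b) ⟨
  m ℤ.* ∏-roots m ([1⋯ b ] ∷ʳ suc b)               ≡⟨ cong (m ℤ.*_) (∏-roots-∷ʳ m [1⋯ b ] (suc b)) ⟩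
  m ℤ.* (∏-roots m [1⋯ b ] ℤ.* (m ℤ.- + suc b))    ≡⟨ ℤ.*-assoc m _ _ ⟨
  m ℤ.* ∏-roots m [1⋯ b ] ℤ.* (m ℤ.- + suc b)      ≡⟨ cong (ℤ._* (m ℤ.- + suc b)) (m*∏-roots≡fallingFactorial m b) ⟩
  fallingFactorial m (suc b) ℤ.* (m ℤ.- + suc b)   ∎

-- Vieta's formula before collecting powers: `S` records the factors `m − x` of the product from
-- which `− x` is chosen, and the others contribute `m`.
∑-sublists-∏-roots : ∀ m xs →
  (∑[ S ∈ sublists xs ] (-1ℤ ℤ.^ length S ℤ.* m ℤ.^ (length xs ∸ length S) ℤ.* + product S)) ≡ ∏-roots m xs
∑-sublists-∏-roots m []       = refl
∑-sublists-∏-roots m (x ∷ xs) = begin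
  ∑ (sublists (x ∷ xs)) (term (suc (length xs)))
    ≡⟨ ∑-sublists-∷ x xs (term (suc (length xs))) ⟩
  ∑ (sublists xs) (term (suc (length xs))) ℤ.+ (∑[ S ∈ sublists xs ] term (suc (length xs)) (x ∷ S))
    ≡⟨ cong₂ ℤ._+_ (∑-cong (sublists xs) without) (∑-cong (sublists xs) λ {S} _ → with-x S) ⟩
  (∑[ S ∈ sublists xs ] (m ℤ.* term (length xs) S)) ℤ.+ (∑[ S ∈ sublists xs ] (ℤ.- + x ℤ.* term (length xs) S))
    ≡⟨ cong₂ ℤ._+_ (*-distribˡ-∑ m (sublists xs) _) (*-distribˡ-∑ (ℤ.- + x) (sublists xs) _) ⟨
  m ℤ.* ∑ (sublists xs) (term (length xs)) ℤ.+ ℤ.- + x ℤ.* ∑ (sublists xs) (term (length xs))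
    ≡⟨ ℤ.*-distribʳ-+ (∑ (sublists xs) (term (length xs))) m (ℤ.- + x) ⟨
  (m ℤ.- + x) ℤ.* ∑ (sublists xs) (term (length xs))
    ≡⟨ cong ((m ℤ.- + x) ℤ.*_) (∑-sublists-∏-roots m xs) ⟩
  (m ℤ.- + x) ℤ.* ∏-roots m xs  ∎
  where
  term : ℕ → List ℕ → ℤ
  term l S = -1ℤ ℤ.^ length S ℤ.* m ℤ.^ (l ∸ length S) ℤ.* + product S

  without : ∀ {S} → S ∈ sublists xs → term (suc (length xs)) S ≡ m ℤ.* term (length xs) S
  -- Subtraction is truncated, so the exponent grows by one with the list only because
  -- `length S ≤ length xs`.
  without {S} S∈ = begin
    term (suc (length xs)) S
      ≡⟨ cong (λ k → -1ℤ ℤ.^ length S ℤ.* m ℤ.^ k ℤ.* + product S)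
              (ℕ.+-∸-assoc 1 (length-∈-sublists xs S∈)) ⟩
    -1ℤ ℤ.^ length S ℤ.* (m ℤ.* m ℤ.^ (length xs ∸ length S)) ℤ.* + product S
      ≡⟨ *-pull (-1ℤ ℤ.^ length S) m _ (+ product S) ⟩
    m ℤ.* term (length xs) S  ∎

  regroup : ∀ s p x q → -1ℤ ℤ.* s ℤ.* p ℤ.* (x ℤ.* q) ≡ ℤ.- x ℤ.* (s ℤ.* p ℤ.* q)
  regroup = solve-∀

  with-x : ∀ S → term (suc (length xs)) (x ∷ S) ≡ ℤ.- + x ℤ.* term (length xs) S
  with-x S = begin
    -1ℤ ℤ.^ suc (length S) ℤ.* m ℤ.^ (length xs ∸ length S) ℤ.* + (x * product S)
      ≡⟨ cong (-1ℤ ℤ.^ suc (length S) ℤ.* m ℤ.^ (length xs ∸ length S) ℤ.*_) (ℤ.pos-* x (product S)) ⟩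
    -1ℤ ℤ.* -1ℤ ℤ.^ length S ℤ.* m ℤ.^ (length xs ∸ length S) ℤ.* (+ x ℤ.* + product S)
      ≡⟨ regroup (-1ℤ ℤ.^ length S) _ (+ x) (+ product S) ⟩
    ℤ.- + x ℤ.* term (length xs) S  ∎

range : ℕ → ℕ → List ℕ
range a b = applyUpTo (λ i → a + i) (suc b ∸ a)

range-unique : ∀ a b → Unique (range a b)
range-unique a b = Unique.applyUpTo⁺₁ (λ i → a + i) (suc b ∸ a)
  λ {i} {j} i<j _ eq → ℕ.<⇒≢ i<j (ℕ.+-cancelˡ-≡ a i j eq)

∈-range⁻ : ∀ {a b w} → w ∈ range a b → a ≤ w × w ≤ b
∈-range⁻ {a} {b} w∈ with ∈-applyUpTo⁻ (λ i → a + i) w∈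
... | i , i< , refl = ℕ.m≤m+n a i , ℕ.s≤s⁻¹
  (subst (_≤ suc b) (cong suc (ℕ.+-comm i a))
         (ℕ.m≤o∸n⇒m+n≤o (suc i) (ℕ.<⇒≤ (ℕ.m∸n≢0⇒n<m (ℕ.m<n⇒n≢0 i<))) i<))

∈-range⁺ : ∀ {a b w} → a ≤ w → w ≤ b → w ∈ range a b
∈-range⁺ {a} {b} a≤w w≤b = subst (_∈ range a b) (ℕ.m+[n∸m]≡n a≤w)
  (∈-applyUpTo⁺ (λ i → a + i) (ℕ.∸-monoˡ-< (s≤s w≤b) a≤w))

-- The substitution k = b + 1 - f makes k the size of the chosen set of roots. As f runs from 1 to b
-- + 1, the list `ks` runs through b, ..., 0, which are exactly the possible sizes of sublists of
-- `[1⋯ b ]`; so grouping Vieta's sum by size leaves nothing out.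
∑-elementarySymmetric : ∀ (m : ℤ) b →
  (∑[ f ∈ range 1 (suc b) ]
    (-1ℤ ℤ.^ (suc b ∸ f) ℤ.* + elementarySymmetric (suc b ∸ f) [1⋯ b ] ℤ.* m ℤ.^ f)) ≡
  fallingFactorial m (suc b)
∑-elementarySymmetric m b = begin
  (∑[ f ∈ range 1 (suc b) ]
    (-1ℤ ℤ.^ (suc b ∸ f) ℤ.* + elementarySymmetric (suc b ∸ f) [1⋯ b ] ℤ.* m ℤ.^ f))
    ≡⟨ ∑-cong (range 1 (suc b)) reindex ⟩
  (∑[ f ∈ range 1 (suc b) ] G (suc b ∸ f))
    ≡⟨ ∑-map (suc b ∸_) (range 1 (suc b)) G ⟨
  ∑ ks G
    ≡⟨ ∑-group length F (λ S → + product S) ks (sublists [1⋯ b ]) ks-unique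
         (λ S∈ ∉ks → contradiction (size∈ks S∈) ∉ks) ⟩
  (∑[ S ∈ sublists [1⋯ b ] ] (F (length S) ℤ.* + product S))
    ≡⟨ ∑-cong (sublists [1⋯ b ]) extract ⟩
  (∑[ S ∈ sublists [1⋯ b ] ] (m ℤ.* (-1ℤ ℤ.^ length S ℤ.* m ℤ.^ (length [1⋯ b ] ∸ length S) ℤ.* + product S)))
    ≡⟨ *-distribˡ-∑ m (sublists [1⋯ b ]) _ ⟨
  m ℤ.* (∑[ S ∈ sublists [1⋯ b ] ] (-1ℤ ℤ.^ length S ℤ.* m ℤ.^ (length [1⋯ b ] ∸ length S) ℤ.* + product S))
    ≡⟨ cong (m ℤ.*_) (∑-sublists-∏-roots m [1⋯ b ]) ⟩
  m ℤ.* ∏-roots m [1⋯ b ]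
    ≡⟨ m*∏-roots≡fallingFactorial m b ⟩
  fallingFactorial m (suc b)  ∎
  where
  F : ℕ → ℤ
  F k = -1ℤ ℤ.^ k ℤ.* m ℤ.^ (suc b ∸ k)

  G : ℕ → ℤ
  G k = F k ℤ.* (∑[ S ∈ sublistsOfSize k [1⋯ b ] ] (+ product S))

  ks : List ℕ
  ks = map (suc b ∸_) (range 1 (suc b))

  ks-unique : Unique ks
  ks-unique rewrite map-applyUpTo suc (suc b ∸_) (suc b) =
    Unique.applyUpTo⁺₁ (b ∸_) (suc b) λ i<j j<1+b eq →
      ℕ.<⇒≢ i<j (ℕ.∸-cancelˡ-≡ (ℕ.<⇒≤ (ℕ.<-≤-trans i<j (ℕ.s≤s⁻¹ j<1+b))) (ℕ.s≤s⁻¹ j<1+b) eq)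

  swapʳ : ∀ x y z → x ℤ.* y ℤ.* z ≡ x ℤ.* z ℤ.* y
  swapʳ = solve-∀

  reindex : ∀ {f} → f ∈ range 1 (suc b) →
    -1ℤ ℤ.^ (suc b ∸ f) ℤ.* + elementarySymmetric (suc b ∸ f) [1⋯ b ] ℤ.* m ℤ.^ f ≡ G (suc b ∸ f)
  reindex {f} f∈ = begin
    -1ℤ ℤ.^ k ℤ.* + elementarySymmetric k [1⋯ b ] ℤ.* m ℤ.^ f
      ≡⟨ swapʳ (-1ℤ ℤ.^ k) (+ elementarySymmetric k [1⋯ b ]) (m ℤ.^ f) ⟩
    -1ℤ ℤ.^ k ℤ.* m ℤ.^ f ℤ.* + elementarySymmetric k [1⋯ b ]
      ≡⟨ cong₂ (λ g s → -1ℤ ℤ.^ k ℤ.* m ℤ.^ g ℤ.* s)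
               (sym (ℕ.m∸[m∸n]≡n (proj₂ (∈-range⁻ {1} {suc b} f∈)))) (+-sum product (sublistsOfSize k [1⋯ b ])) ⟩
    G k  ∎
    where
    k = suc b ∸ f

  |S|≤b : ∀ {S} → S ∈ sublists [1⋯ b ] → length S ≤ b
  |S|≤b S∈ = subst (_ ≤_) (length-applyUpTo suc b) (length-∈-sublists [1⋯ b ] S∈)

  size∈ks : ∀ {S} → S ∈ sublists [1⋯ b ] → length S ∈ ks
  size∈ks {S} S∈ = subst (_∈ ks) (ℕ.m∸[m∸n]≡n (|S|≤b S∈))
    (∈-map⁺ (suc b ∸_) (∈-range⁺ {b = suc b} (s≤s z≤n) (s≤s (ℕ.m∸n≤m b (length S)))))

  extract : ∀ {S} → S ∈ sublists [1⋯ b ] → F (length S) ℤ.* + product S ≡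
            m ℤ.* (-1ℤ ℤ.^ length S ℤ.* m ℤ.^ (length [1⋯ b ] ∸ length S) ℤ.* + product S)
  extract {S} S∈ rewrite length-applyUpTo suc b = begin
    -1ℤ ℤ.^ length S ℤ.* m ℤ.^ (suc b ∸ length S) ℤ.* + product S
      ≡⟨ cong (λ k → -1ℤ ℤ.^ length S ℤ.* m ℤ.^ k ℤ.* + product S) (ℕ.+-∸-assoc 1 (|S|≤b S∈)) ⟩
    -1ℤ ℤ.^ length S ℤ.* (m ℤ.* m ℤ.^ (b ∸ length S)) ℤ.* + product S
      ≡⟨ *-pull (-1ℤ ℤ.^ length S) m _ (+ product S) ⟩
    m ℤ.* (-1ℤ ℤ.^ length S ℤ.* m ℤ.^ (b ∸ length S) ℤ.* + product S)  ∎

-- Inversion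

-- (-1)^(v − s) (n − s choose v − s), and 0 if s > v or s > n.
inversionCoefficient : ℕ → ℕ → ℕ → ℤ
inversionCoefficient n       v       zero    = -1ℤ ℤ.^ v ℤ.* + (n C v)
inversionCoefficient n       zero    (suc s) = 0ℤ
inversionCoefficient zero    (suc v) (suc s) = 0ℤ
inversionCoefficient (suc n) (suc v) (suc s) = inversionCoefficient n v s

inversionCoefficient-> : ∀ n {v s} → v < s → inversionCoefficient n v s ≡ 0ℤ
inversionCoefficient-> n       {zero}  {suc s} _         = refl
inversionCoefficient-> zero    {suc v} {suc s} _         = refl
inversionCoefficient-> (suc n) {suc v} {suc s} (s≤s v<s) = inversionCoefficient-> n v<s

-- Both sides are [s = 0]. This replaces Pascal's rule at v = 0, where there is no smaller v to
-- descend to.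
inversionCoefficient-0 : ∀ n s → inversionCoefficient (suc n) 0 s ≡ inversionCoefficient n 0 s
inversionCoefficient-0 n zero    = refl
inversionCoefficient-0 n (suc s) = refl

-- The two summands carry opposite signs, so this is Pascal's rule solved for C(n - s, v + 1 - s).
-- The bound excludes s = n + 1: there, with v = n, the left side is 1 and the right side 0.
inversionCoefficient-pascal : ∀ {n} v {s} → s ≤ n →
  inversionCoefficient (suc n) (suc v) s ℤ.+ inversionCoefficient n v s ≡ inversionCoefficient n (suc v) s
inversionCoefficient-pascal {n} v {zero} _ = begin
  -1ℤ ℤ.^ suc v ℤ.* + (suc n C suc v) ℤ.+ -1ℤ ℤ.^ v ℤ.* + (n C v)
    ≡⟨ cong (λ c → -1ℤ ℤ.^ suc v ℤ.* + c ℤ.+ -1ℤ ℤ.^ v ℤ.* + (n C v)) (nCk+nC[k+1]≡[n+1]C[k+1] n v) ⟨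
  -1ℤ ℤ.* -1ℤ ℤ.^ v ℤ.* (+ (n C v) ℤ.+ + (n C suc v)) ℤ.+ -1ℤ ℤ.^ v ℤ.* + (n C v)
    ≡⟨ cancel (-1ℤ ℤ.^ v) (+ (n C v)) (+ (n C suc v)) ⟩
  -1ℤ ℤ.* -1ℤ ℤ.^ v ℤ.* + (n C suc v)  ∎
  where
  cancel : ∀ s x y → -1ℤ ℤ.* s ℤ.* (x ℤ.+ y) ℤ.+ s ℤ.* x ≡ -1ℤ ℤ.* s ℤ.* y
  cancel = solve-∀
inversionCoefficient-pascal {suc n} zero    {suc s} _         =
  trans (ℤ.+-identityʳ _) (inversionCoefficient-0 n s)
inversionCoefficient-pascal {suc n} (suc v) {suc s} (s≤s s≤n) = inversionCoefficient-pascal v s≤n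

-- Lowering n, v and w together changes neither n - v nor v - w, so everything reduces to w = 0,
-- where the product is the falling factorial v! C(n, v). The bound w ≤ n lets the descent reach w =
-- 0 before n runs out.
∏-inversionCoefficient : ∀ {n v w} → w ≤ n → w ≤ v →
  -1ℤ ℤ.^ (v ∸ w) ℤ.* (∏[ j from 1 to v ∸ w ] (+ n ℤ.- + v ℤ.+ + j)) ≡
  inversionCoefficient n v w ℤ.* + ((v ∸ w) !)
∏-inversionCoefficient {n} {v} {zero} _ _ = begin
  -1ℤ ℤ.^ v ℤ.* (∏[ j from 1 to v ] (+ n ℤ.- + v ℤ.+ + j))
    ≡⟨ cong (-1ℤ ℤ.^ v ℤ.*_) (∏-fallingFactorial (+ n) v) ⟩
  -1ℤ ℤ.^ v ℤ.* fallingFactorial (+ n) v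
    ≡⟨ cong (-1ℤ ℤ.^ v ℤ.*_) (k!*nCk≡fallingFactorial n v) ⟨
  -1ℤ ℤ.^ v ℤ.* (+ (v !) ℤ.* + (n C v))
    ≡⟨ regroup (-1ℤ ℤ.^ v) (+ (v !)) (+ (n C v)) ⟩
  -1ℤ ℤ.^ v ℤ.* + (n C v) ℤ.* + (v !)  ∎
  where
  regroup : ∀ s f c → s ℤ.* (f ℤ.* c) ≡ s ℤ.* c ℤ.* f
  regroup = solve-∀
∏-inversionCoefficient {suc n} {suc v} {suc w} (s≤s w≤n) (s≤s w≤v) = begin
  -1ℤ ℤ.^ (v ∸ w) ℤ.* (∏[ j from 1 to v ∸ w ] (+ suc n ℤ.- + suc v ℤ.+ + j))
    ≡⟨ cong (λ d → -1ℤ ℤ.^ (v ∸ w) ℤ.* (∏[ j from 1 to v ∸ w ] (d ℤ.+ + j))) (difference (+ n) (+ v)) ⟩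
  -1ℤ ℤ.^ (v ∸ w) ℤ.* (∏[ j from 1 to v ∸ w ] (+ n ℤ.- + v ℤ.+ + j))
    ≡⟨ ∏-inversionCoefficient w≤n w≤v ⟩
  inversionCoefficient n v w ℤ.* + ((v ∸ w) !)  ∎
  where
  difference : ∀ a b → (1ℤ ℤ.+ a) ℤ.- (1ℤ ℤ.+ b) ≡ a ℤ.- b
  difference = solve-∀

module _ {U : A → Set} (U? : Decidable U) (_≟_ : DecidableEquality A) where
  open DecMembership _≟_ using (_∈?_)

  Covers? : (S : List A) → Decidable (λ x → U x → x ∈ S)
  Covers? S x = U? x →-dec (x ∈? S)

  -- For x ∉ U the sets without and with x combine by Pascal's rule; for x ∈ U only the latter occur.
  ∑-covers : ∀ {xs} v → Unique xs →
    (∑[ S ∈ sublists xs ]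
      (⟦ all? (Covers? S) xs ⟧ ℤ.* inversionCoefficient (length xs) v (length S))) ≡
    ⟦ length (filter U? xs) ℕ.≟ v ⟧
  ∑-covers {[]}     zero    _ = refl
  ∑-covers {[]}     (suc v) _ = cong (λ c → 1ℤ ℤ.* c ℤ.+ 0ℤ) (ℤ.*-zeroʳ (-1ℤ ℤ.^ suc v))
  ∑-covers {x ∷ xs} v (x≢ ∷ uniq) = begin
    _  ≡⟨ ∑-sublists-∷ x xs _ ⟩
    without-x v ℤ.+ (∑[ S ∈ sublists xs ] (⟦ all? (Covers? (x ∷ S)) (x ∷ xs) ⟧ ℤ.* c (suc (length S))))
      ≡⟨ cong (λ s → without-x v ℤ.+ s) (∑-cong (sublists xs) λ {S} _ → cong (ℤ._* c (suc (length S))) (cover-∷ S)) ⟩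
    without-x v ℤ.+ with-x v
      ≡⟨ split (U? x) v ⟩
    ⟦ length (filter U? (x ∷ xs)) ℕ.≟ v ⟧  ∎
    where
    l = length xs

    c : ℕ → ℤ
    c = inversionCoefficient (suc l) v

    ⟦_covers⟧ : List A → ℤ
    ⟦ S covers⟧ = ⟦ all? (Covers? S) xs ⟧

    weaken : ∀ {S} → All (λ y → U y → y ∈ S) xs → All (λ y → U y → y ∈ x ∷ S) xs
    weaken = All.map (there ∘_)

    strengthen : ∀ {S} → All (λ y → U y → y ∈ x ∷ S) xs → All (λ y → U y → y ∈ S) xs
    strengthen {S} cov = All.tabulate λ y∈xs u → tail (All.lookup x≢ y∈xs) (All.lookup cov y∈xs u)
      where
      tail : ∀ {y} → x ≢ y → y ∈ x ∷ S → y ∈ S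
      tail x≢y (here refl) = contradiction refl x≢y
      tail x≢y (there y∈S) = y∈S

    cover-∷ : ∀ S → ⟦ all? (Covers? (x ∷ S)) (x ∷ xs) ⟧ ≡ ⟦ S covers⟧
    cover-∷ S = ⟦⟧-cong (all? (Covers? (x ∷ S)) (x ∷ xs)) (all? (Covers? S) xs)
      (λ { (_ ∷ cov) → strengthen cov }) (λ cov → (λ _ → here refl) ∷ weaken cov)

    -- A sublist of `xs` cannot contain `x`, since the list `x ∷ xs` has no repetitions.
    without-∈ : U x → ∀ {S} → S ∈ sublists xs → ⟦ all? (Covers? S) (x ∷ xs) ⟧ ≡ 0ℤ
    without-∈ u {S} S∈ = ⟦⟧-false (all? (Covers? S) (x ∷ xs))
      λ { (x∈S ∷ _) → All.lookup x≢ (lookup (∈-sublists⁻ xs S∈) (x∈S u)) refl }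

    without-∉ : ¬ U x → ∀ S → ⟦ all? (Covers? S) (x ∷ xs) ⟧ ≡ ⟦ S covers⟧
    without-∉ ¬u S = ⟦⟧-cong (all? (Covers? S) (x ∷ xs)) (all? (Covers? S) xs)
      (λ { (_ ∷ cov) → cov }) (λ cov → (λ u → contradiction u ¬u) ∷ cov)

    with-x : ∀ v → ℤ
    with-x v = ∑[ S ∈ sublists xs ] (⟦ S covers⟧ ℤ.* inversionCoefficient (suc l) v (suc (length S)))

    -- Adding `x` raises the length of the list, v and |S| by one each, and the coefficient is
    -- unchanged by definition; what remains is the induction hypothesis.
    with-x≡ : ∀ v → with-x (suc v) ≡ ⟦ length (filter U? xs) ℕ.≟ v ⟧
    with-x≡ v = ∑-covers v uniq

    with-x-0 : with-x 0 ≡ 0ℤ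
    with-x-0 = ∑-zero (sublists xs) λ {S} _ → ℤ.*-zeroʳ ⟦ S covers⟧

    without-x : ∀ v → ℤ
    without-x v = ∑[ S ∈ sublists xs ]
      (⟦ all? (Covers? S) (x ∷ xs) ⟧ ℤ.* inversionCoefficient (suc l) v (length S))

    without-x-∈ : U x → ∀ v → without-x v ≡ 0ℤ
    without-x-∈ u v = ∑-zero (sublists xs) λ {S} S∈ →
      cong (ℤ._* inversionCoefficient (suc l) v (length S)) (without-∈ u S∈)

    without-x-∉ : ¬ U x → ∀ v → without-x v ≡
      (∑[ S ∈ sublists xs ] (⟦ S covers⟧ ℤ.* inversionCoefficient (suc l) v (length S)))
    without-x-∉ ¬u v = ∑-cong (sublists xs) λ {S} _ →
      cong (ℤ._* inversionCoefficient (suc l) v (length S)) (without-∉ ¬u S)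

    split : Dec (U x) → ∀ v → without-x v ℤ.+ with-x v ≡ ⟦ length (filter U? (x ∷ xs)) ℕ.≟ v ⟧
    split (yes u) zero    rewrite filter-accept U? {xs = xs} u = cong₂ ℤ._+_ (without-x-∈ u 0) with-x-0
    split (yes u) (suc v) rewrite filter-accept U? {xs = xs} u = trans (cong₂ ℤ._+_ (without-x-∈ u (suc v)) (with-x≡ v)) (ℤ.+-identityˡ _)
    split (no ¬u) zero    rewrite filter-reject U? {xs = xs} ¬u = begin
      without-x 0 ℤ.+ with-x 0  ≡⟨ cong₂ ℤ._+_ (without-x-∉ ¬u 0) with-x-0 ⟩
      (∑[ S ∈ sublists xs ] (⟦ S covers⟧ ℤ.* inversionCoefficient (suc l) 0 (length S))) ℤ.+ 0ℤ
        ≡⟨ ℤ.+-identityʳ _ ⟩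
      (∑[ S ∈ sublists xs ] (⟦ S covers⟧ ℤ.* inversionCoefficient (suc l) 0 (length S)))
        ≡⟨ ∑-cong (sublists xs) (λ {S} _ → cong (⟦ S covers⟧ ℤ.*_) (inversionCoefficient-0 l (length S))) ⟩
      (∑[ S ∈ sublists xs ] (⟦ S covers⟧ ℤ.* inversionCoefficient l 0 (length S)))
        ≡⟨ ∑-covers 0 uniq ⟩
      ⟦ length (filter U? xs) ℕ.≟ 0 ⟧  ∎
    split (no ¬u) (suc v) rewrite filter-reject U? {xs = xs} ¬u = begin
      without-x (suc v) ℤ.+ with-x (suc v)  ≡⟨ cong (ℤ._+ with-x (suc v)) (without-x-∉ ¬u (suc v)) ⟩
      (∑[ S ∈ sublists xs ] (⟦ S covers⟧ ℤ.* inversionCoefficient (suc l) (suc v) (length S))) ℤ.+ with-x (suc v)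
        ≡⟨ ∑-distrib-+ (sublists xs) _ _ ⟨
      (∑[ S ∈ sublists xs ] (⟦ S covers⟧ ℤ.* inversionCoefficient (suc l) (suc v) (length S) ℤ.+
                             ⟦ S covers⟧ ℤ.* inversionCoefficient l v (length S)))
        ≡⟨ ∑-cong (sublists xs) (λ {S} S∈ → trans
             (sym (ℤ.*-distribˡ-+ ⟦ S covers⟧ _ (inversionCoefficient l v (length S))))
             (cong (⟦ S covers⟧ ℤ.*_) (inversionCoefficient-pascal v (length-∈-sublists xs S∈)))) ⟩
      (∑[ S ∈ sublists xs ] (⟦ S covers⟧ ℤ.* inversionCoefficient l (suc v) (length S)))
        ≡⟨ ∑-covers (suc v) uniq ⟩
      ⟦ length (filter U? xs) ℕ.≟ suc v ⟧  ∎

-- Counting by equivalence classes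

module _ {R : Rel A 0ℓ} (R? : Decidable₂ R)
         (R-refl : Reflexive R) (R-sym : Symmetric R) (R-trans : Transitive R) where

  -- A kept `y` removes its relatives from the later representatives. If `y` is related to `b`,
  -- every later representative related to `b` is thereby removed; if not, none of them is. So at
  -- most one representative is ever related to `b`.
  ∑-deduplicate : ∀ ys b → (∑[ a ∈ deduplicate R? ys ] ⟦ R? a b ⟧) ≡ ⟦ any? (λ a → R? a b) ys ⟧
  ∑-deduplicate []       b = refl
  ∑-deduplicate (y ∷ ys) b =
    trans (cong (λ s → ⟦ R? y b ⟧ ℤ.+ s) (∑-filter (¬? ∘ R? y) (deduplicate R? ys) _)) split
    where
    rest : ℤ
    rest = ∑[ a ∈ deduplicate R? ys ] (⟦ ¬? (R? y a) ⟧ ℤ.* ⟦ R? a b ⟧)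

    related : ∀ {a} → R y b → ⟦ ¬? (R? y a) ⟧ ℤ.* ⟦ R? a b ⟧ ≡ 0ℤ
    related {a} y~b with R? a b
    ... | yes a~b = cong (ℤ._* 1ℤ) (⟦⟧-false (¬? (R? y a)) λ y≁a → y≁a (R-trans y~b (R-sym a~b)))
    ... | no  _   = ℤ.*-zeroʳ ⟦ ¬? (R? y a) ⟧

    unrelated : ∀ {a} → ¬ R y b → ⟦ ¬? (R? y a) ⟧ ℤ.* ⟦ R? a b ⟧ ≡ ⟦ R? a b ⟧
    unrelated {a} y≁b with R? a b
    ... | yes a~b = cong (ℤ._* 1ℤ) (⟦⟧-true (¬? (R? y a)) λ y~a → y≁b (R-trans y~a a~b))
    ... | no  _   = ℤ.*-zeroʳ ⟦ ¬? (R? y a) ⟧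

    split : ⟦ R? y b ⟧ ℤ.+ rest ≡ ⟦ any? (λ a → R? a b) (y ∷ ys) ⟧
    split with R? y b
    ... | yes y~b = cong (λ s → 1ℤ ℤ.+ s) (∑-zero (deduplicate R? ys) λ _ → related y~b)
    ... | no  y≁b = trans (ℤ.+-identityˡ _)
      (trans (∑-cong (deduplicate R? ys) λ _ → unrelated y≁b) (∑-deduplicate ys b))

  -- Pairs (representative, element) are counted from the side of the elements. The classes are
  -- taken in all of `xs`, not only among the elements satisfying `Q`, so `Q` must pass along `R`.
  -- This is asked only inside `xs`: isomorphism preserves the length of edge lists of a graph, but
  -- not of arbitrary lists of pairs.
  ∑-classes : {Q : A → Set} (Q? : Decidable Q) (xs : List A) →
    (∀ {a b} → a ∈ xs → b ∈ xs → R a b → Q a → Q b) →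
    + sum (map (λ a → length (filter (R? a) xs)) (deduplicate R? (filter Q? xs))) ≡
    (∑[ b ∈ xs ] ⟦ Q? b ⟧)
  ∑-classes {Q} Q? xs resp = begin
    + sum (map (λ a → length (filter (R? a) xs)) reps)
      ≡⟨ +-sum (λ a → length (filter (R? a) xs)) reps ⟩
    (∑[ a ∈ reps ] (+ length (filter (R? a) xs)))
      ≡⟨ ∑-cong reps (λ {a} _ → +-length-filter (R? a) xs) ⟩
    (∑[ a ∈ reps ] ∑[ b ∈ xs ] ⟦ R? a b ⟧)
      ≡⟨ ∑-comm reps xs _ ⟩
    (∑[ b ∈ xs ] ∑[ a ∈ reps ] ⟦ R? a b ⟧)
      ≡⟨ ∑-cong xs (λ {b} b∈xs → trans (∑-deduplicate (filter Q? xs) b)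
           (⟦⟧-cong (any? (λ a → R? a b) (filter Q? xs)) (Q? b) (to b∈xs) (from b∈xs))) ⟩
    (∑[ b ∈ xs ] ⟦ Q? b ⟧)  ∎
    where
    reps = deduplicate R? (filter Q? xs)

    to : ∀ {b} → b ∈ xs → Any (λ a → R a b) (filter Q? xs) → Q b
    to b∈xs some with find some
    ... | a , a∈ , a~b with ∈-filter⁻ Q? {xs = xs} a∈
    ...   | a∈xs , Qa = resp a∈xs b∈xs a~b Qa

    from : ∀ {b} → b ∈ xs → Q b → Any (λ a → R a b) (filter Q? xs)
    from b∈xs Qb = lose (∈-filter⁺ Q? b∈xs Qb) R-refl

-- Pigeonhole for lists

⊆-length : ∀ {xs ys : List A} → Unique xs → xs Subset.⊆ ys → length xs ≤ length ys
⊆-length {xs = []}     _             _     = z≤n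
⊆-length {xs = x ∷ xs} (x≢ ∷ uniq) x∷xs⊆ with ∈-∃++ (x∷xs⊆ (here refl))
... | as , bs , refl = subst (suc (length xs) ≤_) (sym lengths) (s≤s (⊆-length uniq xs⊆))
  where
  lengths : length (as ++ x ∷ bs) ≡ suc (length (as ++ bs))
  lengths = begin
    length (as ++ x ∷ bs)         ≡⟨ length-++ as ⟩
    length as + suc (length bs)   ≡⟨ ℕ.+-suc (length as) (length bs) ⟩
    suc (length as + length bs)   ≡⟨ cong suc (length-++ as) ⟨
    suc (length (as ++ bs))       ∎

  xs⊆ : xs Subset.⊆ as ++ bs
  xs⊆ y∈xs with ∈-++⁻ as (x∷xs⊆ (there y∈xs))
  ... | inj₁ y∈as         = ∈-++⁺ˡ y∈as
  ... | inj₂ (here refl)  = contradiction refl (All.lookup x≢ y∈xs)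
  ... | inj₂ (there y∈bs) = ∈-++⁺ʳ as y∈bs

-- A map of `ys` that reaches all of `xs` suffices, with no injectivity to check. The two directions
-- of an isomorphism then give two inequalities, hence equality.
⊆-map-length : ∀ {xs : List A} {ys : List B} (g : B → A) → Unique xs →
           (∀ {x} → x ∈ xs → x ∈ map g ys) → length xs ≤ length ys
⊆-map-length {ys = ys} g uniq xs⊆ = subst (_ ≤_) (length-map g ys) (⊆-length uniq xs⊆)

-- Isomorphism of subgraphs

module _ {n : ℕ} where

  -- `_≅_` asks for tables of values. A table agrees with its function only pointwise, so each
  -- condition is transported value by value.
  ≅-intro : ∀ {A B : Subgraph n} {φ ψ} → IsIsomorphism A B φ ψ → A ≅ B
  ≅-intro {A} {B} {φ} {ψ} (φ-ok , ψ-ok , adj) = tabulate φ , tabulate ψ ,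
      (λ i vi → subst₂ (λ a b → Vertex B a × b ≡ i) (sym (φ≡ i)) (sym (trans (cong ψ′ (φ≡ i)) (ψ≡ (φ i)))) (φ-ok i vi))
    , (λ i vi → subst₂ (λ a b → Vertex A a × b ≡ i) (sym (ψ≡ i)) (sym (trans (cong φ′ (ψ≡ i)) (φ≡ (ψ i)))) (ψ-ok i vi))
    , (λ i j vi vj → subst₂ (λ a b → (Adjacent A i j → Adjacent B a b) × (Adjacent B a b → Adjacent A i j))
                            (sym (φ≡ i)) (sym (φ≡ j)) (adj i j vi vj))
    where
    φ′ ψ′ : Fin n → Fin n
    φ′ = lookupᵛ (tabulate φ)
    ψ′ = lookupᵛ (tabulate ψ)

    φ≡ : ∀ i → φ′ i ≡ φ i
    φ≡ = lookup∘tabulate φ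

    ψ≡ : ∀ i → ψ′ i ≡ ψ i
    ψ≡ = lookup∘tabulate ψ

  ≅-refl : Reflexive (_≅_ {n})
  ≅-refl = ≅-intro {φ = id} {ψ = id} ((λ i vi → vi , refl) , (λ i vi → vi , refl) , (λ i j vi vj → id , id))

  ≅-sym : Symmetric (_≅_ {n})
  ≅-sym {A} {B} (φ , ψ , φ-ok , ψ-ok , adj) = ψ , φ , ψ-ok , φ-ok , λ i j vi vj →
    let vi′ , i≡ = ψ-ok i vi
        vj′ , j≡ = ψ-ok j vj
        to , from = adj (lookupᵛ ψ i) (lookupᵛ ψ j) vi′ vj′
    in  (λ a → from (subst₂ (Adjacent B) (sym i≡) (sym j≡) a)) , (λ a → subst₂ (Adjacent B) i≡ j≡ (to a))

  ≅-trans : Transitive (_≅_ {n})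
  ≅-trans {A} {B} {C} (φ , ψ , φ-ok , ψ-ok , adj) (φ′ , ψ′ , φ′-ok , ψ′-ok , adj′) =
    ≅-intro {φ = lookupᵛ φ′ ∘ lookupᵛ φ} {ψ = lookupᵛ ψ ∘ lookupᵛ ψ′}
      ( (λ i vi → let vb , b≡ = φ-ok i vi
                      vc , c≡ = φ′-ok (lookupᵛ φ i) vb
                  in  vc , trans (cong (lookupᵛ ψ) c≡) b≡)
      , (λ i vi → let vb , b≡ = ψ′-ok i vi
                      va , a≡ = ψ-ok (lookupᵛ ψ′ i) vb
                  in  va , trans (cong (lookupᵛ φ′) a≡) b≡)
      , (λ i j vi vj → let to , from = adj i j vi vj
                           to′ , from′ = adj′ _ _ (proj₁ (φ-ok i vi)) (proj₁ (φ-ok j vj))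
                       in  to′ ∘ to , from ∘ from′))

  cv-mono : ∀ {A B : Subgraph n} → A ≅ B → cv A ≤ cv B
  cv-mono {A} {B} (φ , ψ , φ-ok , _) =
    ⊆-map-length (lookupᵛ ψ) (Unique.filter⁺ (Vertex? A) (Unique.allFin⁺ n)) λ {i} i∈ →
      let vi , i≡ = φ-ok i (proj₂ (∈-filter⁻ (Vertex? A) {xs = allFin n} i∈))
      in  subst (_∈ map (lookupᵛ ψ) (filter (Vertex? B) (allFin n))) i≡
            (∈-map⁺ (lookupᵛ ψ) (∈-filter⁺ (Vertex? B) (∈-allFin (lookupᵛ φ i)) vi))

  cv-cong : ∀ {A B : Subgraph n} → A ≅ B → cv A ≡ cv B
  cv-cong A≅B = ℕ.≤-antisym (cv-mono A≅B) (cv-mono (≅-sym A≅B))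

  -- An isomorphism need not preserve i < j, so images of edges have to be reoriented.
  orient : Edge n → Edge n
  orient (i , j) = if does (i Fin.<? j) then (i , j) else (j , i)

  orient-< : ∀ {i j : Fin n} → i Fin.< j → orient (i , j) ≡ (i , j)
  orient-< {i} {j} i<j rewrite dec-true (i Fin.<? j) i<j = refl

  orient-> : ∀ {i j : Fin n} → i Fin.< j → orient (j , i) ≡ (i , j)
  orient-> {i} {j} i<j rewrite dec-false (j Fin.<? i) (ℕ.<-asym i<j) = refl

  -- `Adjacent` sees neither repetitions nor orientation: `(i , j) ∷ (j , i) ∷ []` is isomorphic to
  -- `(i , j) ∷ []`. Hence the two conditions on `A`, under which every edge of `A` is the
  -- reoriented ψ-image of an edge of `B`.
  size-mono : ∀ {A B : Subgraph n} → Unique A → (∀ {i j} → (i , j) ∈ A → i Fin.< j) → A ≅ B → length A ≤ length B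
  size-mono {A} {B} uniq oriented (φ , ψ , φ-ok , _ , adj) = ⊆-map-length g uniq λ {e} → preimage e
    where
    g : Edge n → Edge n
    g (i , j) = orient (lookupᵛ ψ i , lookupᵛ ψ j)

    preimage : ∀ e → e ∈ A → e ∈ map g B
    preimage (i , j) e∈A with φ-ok i (j , inj₁ e∈A) | φ-ok j (i , inj₂ e∈A)
                            | proj₁ (adj i j (j , inj₁ e∈A) (i , inj₂ e∈A)) (inj₁ e∈A)
    ... | _ , i≡ | _ , j≡ | inj₁ φe∈B =
      subst (_∈ map g B) (trans (cong₂ (λ a b → orient (a , b)) i≡ j≡) (orient-< (oriented e∈A))) (∈-map⁺ g φe∈B)
    -- Here φ reverses the edge: ψ leads back to `(j , i)`, and `orient` restores `(i , j)`.
    ... | _ , i≡ | _ , j≡ | inj₂ φe∈B =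
      subst (_∈ map g B) (trans (cong₂ (λ a b → orient (b , a)) i≡ j≡) (orient-> (oriented e∈A))) (∈-map⁺ g φe∈B)

-- Pairs of vertices and the bound ω

AllPairs-⊆ : ∀ {R : Rel A 0ℓ} {xs ys : List A} → xs ⊆ ys → AllPairs R ys → AllPairs R xs
AllPairs-⊆ []          []         = []
AllPairs-⊆ (y ∷ˢ xs⊆)  (_ ∷ ys)   = AllPairs-⊆ xs⊆ ys
AllPairs-⊆ (refl ∷ xs⊆) (y~ ∷ ys) = anti-mono (lookup xs⊆) y~ ∷ AllPairs-⊆ xs⊆ ys

pairs : List A → List (A × A)
pairs []       = []
pairs (x ∷ xs) = map (x ,_) xs ++ pairs xs

2*pairs+length≡length² : ∀ (xs : List A) → 2 * length (pairs xs) + length xs ≡ length xs * length xs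
2*pairs+length≡length² []       = refl
2*pairs+length≡length² (x ∷ xs) = begin
  2 * length (map (x ,_) xs ++ pairs xs) + suc l
    ≡⟨ cong (λ k → 2 * k + suc l) (trans (length-++ (map (x ,_) xs)) (cong (_+ length (pairs xs)) (length-map _ xs))) ⟩
  2 * (l + length (pairs xs)) + suc l
    ≡⟨ solve 2 (λ l p → con 2 :* (l :+ p) :+ (con 1 :+ l) := con 1 :+ con 2 :* l :+ (con 2 :* p :+ l)) refl l (length (pairs xs)) ⟩
  1 + 2 * l + (2 * length (pairs xs) + l)
    ≡⟨ cong (λ k → 1 + 2 * l + k) (2*pairs+length≡length² xs) ⟩
  1 + 2 * l + l * l
    ≡⟨ solve 1 (λ l → con 1 :+ con 2 :* l :+ l :* l := (con 1 :+ l) :* (con 1 :+ l)) refl l ⟩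
  suc l * suc l  ∎
  where
  open +-*-Solver
  l = length xs

∈-pairs : ∀ {n} {xs : List (Fin n)} {i j} → AllPairs Fin._<_ xs → i Fin.< j → i ∈ xs → j ∈ xs → (i , j) ∈ pairs xs
∈-pairs (x< ∷ sorted) i<j (here refl) (here refl) = contradiction i<j (ℕ.<-irrefl refl)
∈-pairs (x< ∷ sorted) i<j (here refl) (there j∈)  = ∈-++⁺ˡ (∈-map⁺ _ j∈)
∈-pairs (x< ∷ sorted) i<j (there i∈)  (here refl) = contradiction i<j (ℕ.<-asym (All.lookup x< i∈))
∈-pairs {xs = x ∷ xs} (x< ∷ sorted) i<j (there i∈) (there j∈) =
  ∈-++⁺ʳ (map (x ,_) xs) (∈-pairs sorted i<j i∈ j∈)

-- With l elements and p = l (l - 1) / 2 pairs, 1 + 8p = (2l - 1)². Thus e ≤ p puts l above ½ + ½√(1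
-- + 8e), and the ceiling is the least such integer. At e = 0 the empty list would be a
-- counterexample, since ω(0) = 1.
ω-minimal : ∀ {A : Set} {e} (xs : List A) → 1 ≤ e → e ≤ length (pairs xs) → ω e ≤ length xs
ω-minimal []                 1≤e e≤0 = contradiction (ℕ.≤-trans 1≤e e≤0) λ ()
ω-minimal {e = e} (x ∷ xs) _   e≤p =
  ℤ.drop‿+≤+ (proj₂ (ω-isCeiling e) (+ suc k) (subst (√ 1 + 8 * e ≤_) (sym odd) (ℤ.+≤+ z≤n , bound)))
  where
  open +-*-Solver renaming (solve to solveℕ)
  k = length xs
  p = length (pairs (x ∷ xs))

  odd : + 2 ℤ.* + suc k ℤ.- 1ℤ ≡ + suc (2 * k)
  odd = trans (expand (+ k)) (cong (λ t → 1ℤ ℤ.+ t) (sym (ℤ.pos-* 2 k)))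
    where
    expand : ∀ k → + 2 ℤ.* (1ℤ ℤ.+ k) ℤ.- 1ℤ ≡ 1ℤ ℤ.+ + 2 ℤ.* k
    expand = solve-∀

  -- With l = k + 1, adding 4l to both sides avoids subtraction: each becomes 1 + 4l².
  square : 1 + 8 * p ≡ suc (2 * k) * suc (2 * k)
  square = ℕ.+-cancelʳ-≡ (4 * suc k) _ _ (begin
    1 + 8 * p + 4 * suc k
      ≡⟨ solveℕ 2 (λ p w → con 1 :+ con 8 :* p :+ con 4 :* w := con 1 :+ con 4 :* (con 2 :* p :+ w)) refl p (suc k) ⟩
    1 + 4 * (2 * p + suc k)
      ≡⟨ cong (λ t → 1 + 4 * t) (2*pairs+length≡length² (x ∷ xs)) ⟩
    1 + 4 * (suc k * suc k)
      ≡⟨ solveℕ 1 (λ k → con 1 :+ con 4 :* ((con 1 :+ k) :* (con 1 :+ k)) :=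
           (con 1 :+ con 2 :* k) :* (con 1 :+ con 2 :* k) :+ con 4 :* (con 1 :+ k)) refl k ⟩
    suc (2 * k) * suc (2 * k) + 4 * suc k  ∎)

  bound : + (1 + 8 * e) ℤ.≤ + suc (2 * k) ℤ.* + suc (2 * k)
  bound = subst (+ (1 + 8 * e) ℤ.≤_) (trans (cong +_ square) (ℤ.pos-* (suc (2 * k)) (suc (2 * k))))
    (ℤ.+≤+ (s≤s (ℕ.*-monoʳ-≤ 8 e≤p)))

-- Edges of a graph

module _ {n : ℕ} (G : Graph n) where
  open DecMembership (Fin._≟_ {n}) using (_∈?_)

  IsEdge? : Decidable (λ ((i , j) : Edge n) → i Fin.< j × Graph.adj G i j ≡ true)
  IsEdge? (i , j) = (i Fin.<? j) ×-dec (Graph.adj G i j Bool.≟ true)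

  Inside? : (S : List (Fin n)) → Decidable (λ ((i , j) : Edge n) → i ∈ S × j ∈ S)
  Inside? S (i , j) = (i ∈? S) ×-dec (j ∈? S)

  edges-oriented : ∀ {i j} → (i , j) ∈ edges G → i Fin.< j
  edges-oriented ij∈ =
    proj₁ (proj₂ (∈-filter⁻ IsEdge? {xs = cartesianProduct (allFin n) (allFin n)} ij∈))

  edges-unique : Unique (edges G)
  edges-unique = Unique.filter⁺ IsEdge? (Unique.cartesianProduct⁺ (Unique.allFin⁺ n) (Unique.allFin⁺ n))

  length-cong : ∀ {A B} → A ∈ subgraphs G → B ∈ subgraphs G → A ≅ B → length A ≡ length B
  length-cong A∈ B∈ A≅B = ℕ.≤-antisym (mono A∈ A≅B) (mono B∈ (≅-sym A≅B))
    where
    mono : ∀ {A B} → A ∈ subgraphs G → A ≅ B → length A ≤ length B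
    mono A∈ = size-mono (AllPairs-⊆ A⊆ edges-unique) (edges-oriented ∘ lookup A⊆)
      where A⊆ = ∈-sublists⁻ (edges G) A∈

  inducedEdges-bound : ∀ {S e} → 1 ≤ e → S ∈ sublists (allFin n) → length S < ω e → length (inducedEdges G S) < e
  inducedEdges-bound {S} {e} 1≤e S∈ |S|<ω = ℕ.≰⇒> λ e≤m →
    ℕ.<⇒≱ |S|<ω (ω-minimal S 1≤e (ℕ.≤-trans e≤m (⊆-length (Unique.filter⁺ (Inside? S) edges-unique) inside)))
    where
    sorted : AllPairs Fin._<_ S
    sorted = AllPairs-⊆ (∈-sublists⁻ (allFin n) S∈) (AllPairs.tabulate⁺-< id)

    inside : ∀ {ij} → ij ∈ inducedEdges G S → ij ∈ pairs S
    inside ij∈ =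
      let ij∈E , i∈S , j∈S = ∈-filter⁻ (Inside? S) {xs = edges G} ij∈
      in  ∈-pairs sorted (edges-oriented ij∈E) i∈S j∈S

  -- Every vertex of `A` is an endpoint of an edge of `A`. This joins the inversion identity, a
  -- condition on vertices, to the counting of edge sets, a condition on edges.
  covers⇔inside : ∀ A S → ⟦ all? (Covers? (Vertex? A) Fin._≟_ S) (allFin n) ⟧ ≡ ⟦ all? (Inside? S) A ⟧
  covers⇔inside A S = ⟦⟧-cong (all? (Covers? (Vertex? A) Fin._≟_ S) (allFin n)) (all? (Inside? S) A)
    (λ cov → All.tabulate λ {(i , j)} ij∈A →
      All.lookup cov (∈-allFin i) (j , inj₁ ij∈A) , All.lookup cov (∈-allFin j) (i , inj₂ ij∈A))
    (λ ins → All.tabulate λ _ → λ where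
      (_ , inj₁ ij∈A) → proj₁ (All.lookup ins ij∈A)
      (_ , inj₂ ji∈A) → proj₂ (All.lookup ins ji∈A))

  σ-count : ∀ e v → + σ G e v ≡ (∑[ A ∈ subgraphs G ] ⟦ (cv A ℕ.≟ v) ×-dec (length A ℕ.≟ e) ⟧)
  σ-count e v = ∑-classes _≅?_ ≅-refl ≅-sym ≅-trans (λ A → (cv A ℕ.≟ v) ×-dec (length A ℕ.≟ e)) (subgraphs G)
    λ A∈ B∈ A≅B (cvA≡v , |A|≡e) → trans (sym (cv-cong A≅B)) cvA≡v , trans (sym (length-cong A∈ B∈ A≅B)) |A|≡e

  -- Double counting of the pairs (A, S) with `A` inside `S`, weighted by the coefficient of `S`.
  -- For fixed `A` the weights add up to [cv(A) = v]; for fixed `S` the subgraphs with e edges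
  -- number C(m, e).
  σ-inversion : ∀ e v → + σ G e v ≡
    (∑[ S ∈ sublists (allFin n) ] (inversionCoefficient n v (length S) ℤ.* + (length (inducedEdges G S) C e)))
  σ-inversion e v = begin
    + σ G e v
      ≡⟨ σ-count e v ⟩
    (∑[ A ∈ subgraphs G ] ⟦ (cv A ℕ.≟ v) ×-dec (length A ℕ.≟ e) ⟧)
      ≡⟨ ∑-cong (subgraphs G) (λ {A} _ → begin
           ⟦ (cv A ℕ.≟ v) ×-dec (length A ℕ.≟ e) ⟧
             ≡⟨ ⟦⟧-× (cv A ℕ.≟ v) (length A ℕ.≟ e) ⟩
           ⟦ cv A ℕ.≟ v ⟧ ℤ.* ⟦ length A ℕ.≟ e ⟧
             ≡⟨ ℤ.*-comm ⟦ cv A ℕ.≟ v ⟧ _ ⟩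
           ⟦ length A ℕ.≟ e ⟧ ℤ.* ⟦ cv A ℕ.≟ v ⟧
             ≡⟨ cong (⟦ length A ℕ.≟ e ⟧ ℤ.*_) (cover A) ⟩
           ⟦ length A ℕ.≟ e ⟧ ℤ.* (∑[ S ∈ sublists (allFin n) ] (⟦ all? (Inside? S) A ⟧ ℤ.* c S))
             ≡⟨ *-distribˡ-∑ ⟦ length A ℕ.≟ e ⟧ (sublists (allFin n)) _ ⟩
           (∑[ S ∈ sublists (allFin n) ] (⟦ length A ℕ.≟ e ⟧ ℤ.* (⟦ all? (Inside? S) A ⟧ ℤ.* c S)))  ∎) ⟩
    (∑[ A ∈ subgraphs G ] ∑[ S ∈ sublists (allFin n) ] (⟦ length A ℕ.≟ e ⟧ ℤ.* (⟦ all? (Inside? S) A ⟧ ℤ.* c S)))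
      ≡⟨ ∑-comm (subgraphs G) (sublists (allFin n)) _ ⟩
    (∑[ S ∈ sublists (allFin n) ] ∑[ A ∈ subgraphs G ] (⟦ length A ℕ.≟ e ⟧ ℤ.* (⟦ all? (Inside? S) A ⟧ ℤ.* c S)))
      ≡⟨ ∑-cong (sublists (allFin n)) (λ {S} _ → begin
           (∑[ A ∈ subgraphs G ] (⟦ length A ℕ.≟ e ⟧ ℤ.* (⟦ all? (Inside? S) A ⟧ ℤ.* c S)))
             ≡⟨ ∑-cong (subgraphs G) (λ {A} _ → regroup ⟦ length A ℕ.≟ e ⟧ ⟦ all? (Inside? S) A ⟧ (c S)) ⟩
           (∑[ A ∈ subgraphs G ] (c S ℤ.* (⟦ all? (Inside? S) A ⟧ ℤ.* ⟦ length A ℕ.≟ e ⟧)))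
             ≡⟨ *-distribˡ-∑ (c S) (subgraphs G) _ ⟨
           c S ℤ.* (∑[ A ∈ subgraphs G ] (⟦ all? (Inside? S) A ⟧ ℤ.* ⟦ length A ℕ.≟ e ⟧))
             ≡⟨ cong (c S ℤ.*_) (∑-sublists-filter (Inside? S) (edges G) (λ A → ⟦ length A ℕ.≟ e ⟧)) ⟩
           c S ℤ.* (∑[ A ∈ sublists (inducedEdges G S) ] ⟦ length A ℕ.≟ e ⟧)
             ≡⟨ cong (c S ℤ.*_) (∑-sublists-size e (inducedEdges G S)) ⟩
           c S ℤ.* + (length (inducedEdges G S) C e)  ∎) ⟩
    (∑[ S ∈ sublists (allFin n) ] (c S ℤ.* + (length (inducedEdges G S) C e)))  ∎
    where
    c : List (Fin n) → ℤ
    c S = inversionCoefficient n v (length S)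

    regroup : ∀ x y z → x ℤ.* (y ℤ.* z) ≡ z ℤ.* (y ℤ.* x)
    regroup = solve-∀

    cover : ∀ A → ⟦ cv A ℕ.≟ v ⟧ ≡ (∑[ S ∈ sublists (allFin n) ] (⟦ all? (Inside? S) A ⟧ ℤ.* c S))
    cover A = begin
      ⟦ cv A ℕ.≟ v ⟧
        ≡⟨ ∑-covers (Vertex? A) Fin._≟_ v (Unique.allFin⁺ n) ⟨
      (∑[ S ∈ sublists (allFin n) ]
        (⟦ all? (Covers? (Vertex? A) Fin._≟_ S) (allFin n) ⟧ ℤ.*
         inversionCoefficient (length (allFin n)) v (length S)))
        ≡⟨ ∑-cong (sublists (allFin n)) (λ {S} _ →
             cong₂ (λ x l → x ℤ.* inversionCoefficient l v (length S)) (covers⇔inside A S) (length-tabulate id)) ⟩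
      (∑[ S ∈ sublists (allFin n) ] (⟦ all? (Inside? S) A ⟧ ℤ.* c S))  ∎

  inducedCount : ℕ → ℕ → ℤ
  inducedCount e w = ∑[ S ∈ sublistsOfSize w (allFin n) ] (+ (length (inducedEdges G S) C e))

  -- Both limits of the sum over w come from vanishing terms: above v the coefficient is 0, and
  -- below ω(e) there are too few edges, so the binomial coefficient is 0.
  σ-by-size : ∀ {e} v → 1 ≤ e →
    + σ G e v ≡ (∑[ w ∈ range (ω e) v ] (inversionCoefficient n v w ℤ.* inducedCount e w))
  σ-by-size {e} v 1≤e = trans (σ-inversion e v) (sym
    (∑-group length (inversionCoefficient n v) _ (range (ω e) v) (sublists (allFin n)) (range-unique (ω e) v) outside))
    where
    outside : ∀ {S} → S ∈ sublists (allFin n) → length S ∉ range (ω e) v →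
              inversionCoefficient n v (length S) ℤ.* + (length (inducedEdges G S) C e) ≡ 0ℤ
    outside {S} S∈ ∉range = vanish (length S ℕ.≤? v)
      where
      count : ℤ
      count = + (length (inducedEdges G S) C e)

      vanish : Dec (length S ≤ v) → inversionCoefficient n v (length S) ℤ.* count ≡ 0ℤ
      vanish (no  |S|≰v) = cong (ℤ._* count) (inversionCoefficient-> n (ℕ.≰⇒> |S|≰v))
      vanish (yes |S|≤v) = trans
        (cong (λ k → inversionCoefficient n v (length S) ℤ.* + k)
          (k>n⇒nCk≡0 (inducedEdges-bound 1≤e S∈ (ℕ.≰⇒> λ ω≤|S| → ∉range (∈-range⁺ ω≤|S| |S|≤v)))))
        (ℤ.*-zeroʳ (inversionCoefficient n v (length S)))

-- Fractions

-- `_/_` reduces to lowest terms, so the equation is checked on unnormalised fractions, where it is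
-- cross-multiplication.
+-/ : ∀ a b d .{{_ : ℕ.NonZero d}} → a / d ℚ.+ b / d ≡ (a ℤ.+ b) / d
+-/ a b (suc d) = ℚ.toℚᵘ-injective (ℚᵘ.≃-trans (ℚ.toℚᵘ-homo-+ (a / suc d) (b / suc d))
  (ℚᵘ.≃-trans (ℚᵘ.+-cong (ℚ.toℚᵘ-fromℚᵘ (mkℚᵘ a d)) (ℚ.toℚᵘ-fromℚᵘ (mkℚᵘ b d)))
  (ℚᵘ.≃-trans (*≡* (trans (common a b (+ suc d)) (cong ((a ℤ.+ b) ℤ.*_) (sym (ℤ.pos-* (suc d) (suc d))))))
              (ℚᵘ.≃-sym (ℚ.toℚᵘ-fromℚᵘ (mkℚᵘ (a ℤ.+ b) d))))))
  where
  common : ∀ a b d → (a ℤ.* d ℤ.+ b ℤ.* d) ℤ.* d ≡ (a ℤ.+ b) ℤ.* (d ℤ.* d)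
  common = solve-∀

*-/ : ∀ a b d .{{_ : ℕ.NonZero d}} → (a / d) ℚ.* (b / 1) ≡ (a ℤ.* b) / d
*-/ a b (suc d) = ℚ.toℚᵘ-injective (ℚᵘ.≃-trans (ℚ.toℚᵘ-homo-* (a / suc d) (b / 1))
  (ℚᵘ.≃-trans (ℚᵘ.*-cong (ℚ.toℚᵘ-fromℚᵘ (mkℚᵘ a d)) (ℚ.toℚᵘ-fromℚᵘ (mkℚᵘ b 0)))
  (ℚᵘ.≃-trans (*≡* (cong (λ k → a ℤ.* b ℤ.* + k) (sym (ℕ.*-identityʳ (suc d)))))
              (ℚᵘ.≃-sym (ℚ.toℚᵘ-fromℚᵘ (mkℚᵘ (a ℤ.* b) d))))))

*-cancel-/ : ∀ a d .{{_ : ℕ.NonZero d}} → (a ℤ.* + d) / d ≡ a / 1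
*-cancel-/ a (suc d) = ℚ.fromℚᵘ-cong {mkℚᵘ (a ℤ.* + suc d) d} {mkℚᵘ a 0} (*≡* (ℤ.*-identityʳ _))

0/d≡0 : ∀ d .{{_ : ℕ.NonZero d}} → 0ℤ / d ≡ ℚ.0ℚ
0/d≡0 d = *-cancel-/ 0ℤ d

-- The enumeration `g` is arbitrary because the tail of `applyUpTo g` enumerates by `g ∘ suc`.
-- Restricting the premise to listed values makes the bounds on the index available when it is
-- proved.
sum-/ : ∀ (g : ℕ → ℕ) (F : ℕ → ℚ) (z : ℕ → ℤ) d .{{_ : ℕ.NonZero d}} k →
        (∀ {w} → w ∈ applyUpTo g k → F w ≡ z w / d) →
        Σℚ.sum {k} (λ i → F (g (toℕ i))) ≡ ∑ (applyUpTo g k) z / d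
sum-/ g F z d zero    F≡ = sym (0/d≡0 d)
sum-/ g F z d (suc k) F≡ = begin
  F (g 0) ℚ.+ Σℚ.sum {k} (λ i → F (g (suc (toℕ i))))
    ≡⟨ cong₂ ℚ._+_ (F≡ (here refl)) (sum-/ (g ∘ suc) F z d k (F≡ ∘ there)) ⟩
  z (g 0) / d ℚ.+ ∑ (applyUpTo (g ∘ suc) k) z / d
    ≡⟨ +-/ (z (g 0)) _ d ⟩
  (z (g 0) ℤ.+ ∑ (applyUpTo (g ∘ suc) k) z) / d  ∎

sumFromTo-/ : ∀ a b (F : ℕ → ℚ) (z : ℕ → ℤ) d .{{_ : ℕ.NonZero d}} →
              (∀ {w} → w ∈ range a b → F w ≡ z w / d) → (∑[ w from a to b ] F w) ≡ ∑ (range a b) z / d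
sumFromTo-/ a b F z d = sum-/ (λ i → a + i) F z d (suc b ∸ a)

pos-^ : ∀ m k → + (m ^ k) ≡ (+ m) ℤ.^ k
pos-^ m zero    = refl
pos-^ m (suc k) = trans (ℤ.pos-* m (m ^ k)) (cong (+ m ℤ.*_) (pos-^ m k))

-- From binomial counts to h, and the theorem

module _ {n : ℕ} (G : Graph n) where

  -- After the sums are exchanged, each `S` contributes the power expansion of the falling factorial
  -- at its number of edges.
  ∑-h : ∀ b w →
    (∑[ f ∈ range 1 (suc b) ]
      (-1ℤ ℤ.^ (suc b ∸ f) ℤ.* + elementarySymmetric (suc b ∸ f) [1⋯ b ] ℤ.* + h G f w)) ≡
    + (suc b !) ℤ.* inducedCount G (suc b) w
  ∑-h b w = begin
    (∑[ f ∈ range 1 (suc b) ] (s f ℤ.* + h G f w))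
      ≡⟨ ∑-cong (range 1 (suc b)) (λ {f} _ → begin
           s f ℤ.* + h G f w
             ≡⟨ cong (s f ℤ.*_) (+-sum (λ S → size S ^ f) Ss) ⟩
           s f ℤ.* (∑[ S ∈ Ss ] (+ (size S ^ f)))
             ≡⟨ *-distribˡ-∑ (s f) Ss _ ⟩
           (∑[ S ∈ Ss ] (s f ℤ.* + (size S ^ f)))
             ≡⟨ ∑-cong Ss (λ {S} _ → cong (s f ℤ.*_) (pos-^ (size S) f)) ⟩
           (∑[ S ∈ Ss ] (s f ℤ.* (+ size S) ℤ.^ f))  ∎) ⟩
    (∑[ f ∈ range 1 (suc b) ] ∑[ S ∈ Ss ] (s f ℤ.* (+ size S) ℤ.^ f))
      ≡⟨ ∑-comm (range 1 (suc b)) Ss _ ⟩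
    (∑[ S ∈ Ss ] ∑[ f ∈ range 1 (suc b) ] (s f ℤ.* (+ size S) ℤ.^ f))
      ≡⟨ ∑-cong Ss (λ {S} _ → trans (∑-elementarySymmetric (+ size S) b)
                                    (sym (k!*nCk≡fallingFactorial (size S) (suc b)))) ⟩
    (∑[ S ∈ Ss ] (+ (suc b !) ℤ.* + (size S C suc b)))
      ≡⟨ *-distribˡ-∑ (+ (suc b !)) Ss _ ⟨
    + (suc b !) ℤ.* inducedCount G (suc b) w  ∎
    where
    s : ℕ → ℤ
    s f = -1ℤ ℤ.^ (suc b ∸ f) ℤ.* + elementarySymmetric (suc b ∸ f) [1⋯ b ]

    size : List (Fin n) → ℕ
    size S = length (inducedEdges G S)

    Ss : List (List (Fin n))
    Ss = sublistsOfSize w (allFin n)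

  inducedCount-> : ∀ e {w} → n < w → inducedCount G e w ≡ 0ℤ
  inducedCount-> e {w} n<w = ∑-zero (sublistsOfSize w (allFin n)) λ {S} S∈ →
    let S∈all , |S|≡w = ∈-filter⁻ (λ S → length S ℕ.≟ w) {xs = sublists (allFin n)} S∈
    in  contradiction n<w (ℕ.≤⇒≯ (subst₂ _≤_ |S|≡w (length-tabulate id) (length-∈-sublists (allFin n) S∈all)))

  -- The sign (-1)^{v-w} and the product over j do not depend on f and come out of the sum. The
  -- result is visibly a multiple of the denominator e! (v - w)!.
  ∑-numerators : ∀ b {v w} → w ≤ v →
    (∑[ f ∈ range 1 (suc b) ]
      (-1ℤ ℤ.^ ((suc b ∸ f) + (v ∸ w))
         ℤ.* + elementarySymmetric (suc b ∸ f) [1⋯ b ]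
         ℤ.* (∏[ j from 1 to v ∸ w ] (+ n ℤ.- + v ℤ.+ + j))
         ℤ.* + h G f w)) ≡
    inversionCoefficient n v w ℤ.* inducedCount G (suc b) w ℤ.* + (suc b ! * (v ∸ w) !)
  ∑-numerators b {v} {w} w≤v = begin
    (∑[ f ∈ range 1 (suc b) ]
      (-1ℤ ℤ.^ ((suc b ∸ f) + (v ∸ w)) ℤ.* + elementarySymmetric (suc b ∸ f) [1⋯ b ] ℤ.* Π ℤ.* + h G f w))
      ≡⟨ ∑-cong (range 1 (suc b)) (λ {f} _ → trans
           (cong (λ s → s ℤ.* + elementarySymmetric (suc b ∸ f) [1⋯ b ] ℤ.* Π ℤ.* + h G f w)
                 (ℤ.^-distribˡ-+-* -1ℤ (suc b ∸ f) (v ∸ w)))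
           (regroup (-1ℤ ℤ.^ (suc b ∸ f)) (-1ℤ ℤ.^ (v ∸ w)) (+ elementarySymmetric (suc b ∸ f) [1⋯ b ]) Π (+ h G f w))) ⟩
    (∑[ f ∈ range 1 (suc b) ]
      (-1ℤ ℤ.^ (v ∸ w) ℤ.* Π ℤ.*
        (-1ℤ ℤ.^ (suc b ∸ f) ℤ.* + elementarySymmetric (suc b ∸ f) [1⋯ b ] ℤ.* + h G f w)))
      ≡⟨ *-distribˡ-∑ (-1ℤ ℤ.^ (v ∸ w) ℤ.* Π) (range 1 (suc b)) _ ⟨
    -1ℤ ℤ.^ (v ∸ w) ℤ.* Π ℤ.*
      (∑[ f ∈ range 1 (suc b) ]
        (-1ℤ ℤ.^ (suc b ∸ f) ℤ.* + elementarySymmetric (suc b ∸ f) [1⋯ b ] ℤ.* + h G f w))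
      ≡⟨ cong (-1ℤ ℤ.^ (v ∸ w) ℤ.* Π ℤ.*_) (∑-h b w) ⟩
    -1ℤ ℤ.^ (v ∸ w) ℤ.* Π ℤ.* (+ (suc b !) ℤ.* N)
      ≡⟨ cancel (w ℕ.≤? n) ⟩
    D ℤ.* N ℤ.* (+ (suc b !) ℤ.* + ((v ∸ w) !))
      ≡⟨ cong (D ℤ.* N ℤ.*_) (ℤ.pos-* (suc b !) ((v ∸ w) !)) ⟨
    D ℤ.* N ℤ.* + (suc b ! * (v ∸ w) !)  ∎
    where
    Π = ∏[ j from 1 to v ∸ w ] (+ n ℤ.- + v ℤ.+ + j)
    D = inversionCoefficient n v w
    N = inducedCount G (suc b) w

    regroup : ∀ s t y p x → s ℤ.* t ℤ.* y ℤ.* p ℤ.* x ≡ t ℤ.* p ℤ.* (s ℤ.* y ℤ.* x)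
    regroup = solve-∀

    exchange : ∀ d f g x → d ℤ.* f ℤ.* (g ℤ.* x) ≡ d ℤ.* x ℤ.* (g ℤ.* f)
    exchange = solve-∀

    vanish : ∀ k g d f → k ℤ.* (g ℤ.* 0ℤ) ≡ d ℤ.* 0ℤ ℤ.* (g ℤ.* f)
    vanish = solve-∀

    cancel : Dec (w ≤ n) → -1ℤ ℤ.^ (v ∸ w) ℤ.* Π ℤ.* (+ (suc b !) ℤ.* N) ≡
                           D ℤ.* N ℤ.* (+ (suc b !) ℤ.* + ((v ∸ w) !))
    cancel (yes w≤n) = trans (cong (ℤ._* (+ (suc b !) ℤ.* N)) (∏-inversionCoefficient w≤n w≤v))
      (exchange D (+ ((v ∸ w) !)) (+ (suc b !)) N)
    -- For w > n the product is not a binomial coefficient, but there are no w-subsets.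
    cancel (no w≰n)  rewrite inducedCount-> (suc b) (ℕ.≰⇒> w≰n) =
      vanish (-1ℤ ℤ.^ (v ∸ w) ℤ.* Π) (+ (suc b !)) D (+ ((v ∸ w) !))

theorem5 : ∀ {n} (G : Graph n) (e v : ℕ) → 1 ≤ e →
    + σ G e v / 1 ≡
    (∑[ w from ω e to v ] ∑[ f from 1 to e ]
    (-1ℤ ℤ.^ ((e ∸ f) + (v ∸ w))
    ℤ.* + elementarySymmetric (e ∸ f) [1⋯ e ∸ 1 ]
    ℤ.* (∏[ j from 1 to v ∸ w ] (+ n ℤ.- + v ℤ.+ + j))
    / (e ! * (v ∸ w) !)) {{e !* (v ∸ w) !≢0}}
    ℚ.* (+ h G f w / 1))
theorem5 {n} G e@(suc b) v 1≤e = begin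
  + σ G e v / 1
    ≡⟨ cong (_/ 1) (σ-by-size G v 1≤e) ⟩
  (∑[ w ∈ range (ω e) v ] (inversionCoefficient n v w ℤ.* inducedCount G e w)) / 1
    -- The denominator varies with w, so it is cleared inside each w-term, and the outer sum is
    -- taken over denominator 1. Membership in the range supplies the w ≤ v that `∑-numerators`
    -- requires.
    ≡⟨ sumFromTo-/ (ω e) v _ (λ w → inversionCoefficient n v w ℤ.* inducedCount G e w) 1 (λ {w} w∈ → begin
         _ ≡⟨ sumFromTo-/ 1 e _ (λ f → a w f ℤ.* + h G f w) (e ! * (v ∸ w) !) {{e !* (v ∸ w) !≢0}}
                (λ {f} _ → *-/ (a w f) (+ h G f w) (e ! * (v ∸ w) !) {{e !* (v ∸ w) !≢0}}) ⟩
         ((∑[ f ∈ range 1 e ] (a w f ℤ.* + h G f w)) / (e ! * (v ∸ w) !)) {{e !* (v ∸ w) !≢0}}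
           ≡⟨ cong (λ x → (x / (e ! * (v ∸ w) !)) {{e !* (v ∸ w) !≢0}}) (∑-numerators G b (proj₂ (∈-range⁻ {ω e} w∈))) ⟩
         (inversionCoefficient n v w ℤ.* inducedCount G e w ℤ.* + (e ! * (v ∸ w) !) / (e ! * (v ∸ w) !)) {{e !* (v ∸ w) !≢0}}
           ≡⟨ *-cancel-/ (inversionCoefficient n v w ℤ.* inducedCount G e w) (e ! * (v ∸ w) !) {{e !* (v ∸ w) !≢0}} ⟩
         (inversionCoefficient n v w ℤ.* inducedCount G e w) / 1  ∎) ⟨
  _  ∎
  where
  a : ℕ → ℕ → ℤ
  a w f = -1ℤ ℤ.^ ((e ∸ f) + (v ∸ w))
    ℤ.* + elementarySymmetric (e ∸ f) [1⋯ e ∸ 1 ]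
    ℤ.* (∏[ j from 1 to v ∸ w ] (+ n ℤ.- + v ℤ.+ + j))
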